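{- For any integer $k\geq 1$, any $i\in\{1,\dots,k\}$ and any integer $n\geq 0$, the number of partitions of $n$ into parts that are not congruent to $2$ modulo $4$ and not congruent to $0$, $2k+(2i-1)$ or $2k-(2i-1)$ modulo $4k$ equals the number of partitions $(b_1,\dots,b_s)$ of $n$, with $b_1\geq b_2\geq\cdots\geq b_s$, such that no odd part is repeated, $b_p-b_{p+k-1}\geq 2$ whenever $p+k-1\leq s$ and $b_p$ is odd, $b_p-b_{p+k-1}>2$ whenever $p+k-1\leq s$ and $b_p$ is even, and at most $k-i$ parts are equal to $1$ or $2$. -}

module Defs where

open import Data.Bool using (Bool; true; false; T; _∧_; _∨_; not; if_then_else_)
open import Data.Nat using (ℕ; zero; suc; _+_; _*_; _∸_; _≡ᵇ_; _≤ᵇ_; _<ᵇ_; NonZero)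
open import Data.Nat.DivMod using (_%_)
open import Data.Nat.ListAction using (sum)
open import Data.List using (List; []; _∷_; drop)
open import Data.Product using (Σ; proj₁)
open import Relation.Binary.PropositionalEquality using (_≡_)

-- All predicates are Bool-valued (wrapped with T), so that each
-- subset type below is a genuine subset of List ℕ (proof-irrelevant
-- membership), and "equal number of partitions" = bijection.

all : (ℕ → Bool) → List ℕ → Bool
all P []       = true
all P (x ∷ xs) = P x ∧ all P xs

decreasing : List ℕ → Bool
decreasing []           = true
decreasing (x ∷ [])     = true
decreasing (x ∷ y ∷ xs) = (y ≤ᵇ x) ∧ decreasing (y ∷ xs)

isPartition : ℕ → List ℕ → Bool
isPartition n b = all (1 ≤ᵇ_) b ∧ decreasing b ∧ (sum b ≡ᵇ n)

Partition : ℕ → Set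
Partition n = Σ (List ℕ) (λ b → T (isPartition n b))

odd : ℕ → Bool
odd x = x % 2 ≡ᵇ 1

allowedPart : (k i : ℕ) → .{{NonZero k}} → ℕ → Bool
allowedPart k@(suc _) i x =
  not (x % 4 ≡ᵇ 2) ∧
  not (x % (4 * k) ≡ᵇ 0) ∧
  not (x % (4 * k) ≡ᵇ (2 * k + (2 * i ∸ 1)) % (4 * k)) ∧
  not (x % (4 * k) ≡ᵇ (2 * k + 1) ∸ 2 * i)

LHS : (k i : ℕ) → .{{NonZero k}} → ℕ → Set
LHS k i n = Σ (Partition n) λ P → T (all (allowedPart k i) (proj₁ P))

-- no odd part is repeated (equal parts are adjacent in a decreasing list)
noRepeatedOdd : List ℕ → Bool
noRepeatedOdd []           = true
noRepeatedOdd (x ∷ [])     = true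
noRepeatedOdd (x ∷ y ∷ xs) = not (odd x ∧ (x ≡ᵇ y)) ∧ noRepeatedOdd (y ∷ xs)

index : List ℕ → ℕ → Σ Bool (λ _ → ℕ)
index []       _       = (false Data.Product., 0)
index (x ∷ xs) zero    = (true Data.Product., x)
index (x ∷ xs) (suc j) = index xs j

-- difference condition at the head: with b = b_p ∷ rest,
-- if b_{p+k-1} exists (index k-1 of b) then
-- b_p - b_{p+k-1} ≥ 2 when b_p odd, and > 2 when b_p even.
headDiff : ℕ → List ℕ → Bool
headDiff k []      = true
headDiff k (x ∷ xs) with index (x ∷ xs) (k ∸ 1)
... | (false Data.Product., _) = true
... | (true  Data.Product., y) =
  if odd x then (y + 2 ≤ᵇ x) else (y + 2 <ᵇ x)

diffCond : ℕ → List ℕ → Bool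
diffCond k []       = true
diffCond k (x ∷ xs) = headDiff k (x ∷ xs) ∧ diffCond k xs

countOneTwo : List ℕ → ℕ
countOneTwo []       = 0
countOneTwo (x ∷ xs) =
  (if (x ≡ᵇ 1) ∨ (x ≡ᵇ 2) then 1 else 0) + countOneTwo xs

RHS : (k i : ℕ) → ℕ → Set
RHS k i n = Σ (Partition n) λ P →
  T (noRepeatedOdd (proj₁ P) ∧ diffCond k (proj₁ P) ∧ (countOneTwo (proj₁ P) ≤ᵇ k ∸ i))

{-# OPTIONS --safe #-}
module Submission where

-- Put p = q² and x = p^j.  Let D_{j,i} be the generating function of the partitions with all parts > 2j which
-- satisfy the gap conditions and have fewer than i parts equal to 2j+1 or 2j+2.  Removing these smallest parts
-- gives a recursion expressing D_j through D_{j+1}.  The same recursion holds for Andrews' series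
-- J_{k,i}(-1/q; x; q²), and both sides become trivial as j → ∞, so they agree up to the factor ∏ (1 - p^m).
-- At x = 1 the series J is ∏ (1 + q p^m) times a theta series, which the Jacobi triple product turns into the
-- infinite product generating the partitions with allowed parts.
--
-- Everything is computed modulo q^N for some N > n.  There q is nilpotent, all the sums and products involved
-- are finite, and the two generating functions enumerate finite lists of partitions.

open import Defs
open import Data.Nat using (ℕ; _≤_; NonZero)
open import Function.Bundles using (_↔_)

open import Algebra.Bundles using (CommutativeMonoid; CommutativeSemiring)
open import Data.Bool using (Bool; true; false; T; _∧_; not; if_then_else_)
open import Data.List using (List; []; _∷_; _++_; map; replicate)
open import Data.Nat as ℕ using (zero; suc; z≤n; s≤s)
open import Data.Nat.Divisibility using (divides)
open import Data.Nat.DivMod using (_%_; [m+n]%n≡m%n; m<n⇒m%n≡m; n%n≡0; m∣n⇒o%n%m≡o%m; m*n%n≡0; [m+kn]%n≡m%n)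
open import Data.Nat.ListAction using (sum)
open import Data.Nat.ListAction.Properties using (sum-++)
import Data.Nat.Properties as ℕₚ
import Data.Nat.Solver as ℕSolver
open import Data.Product using (_×_; _,_)
open import Data.Sum using (inj₁; inj₂)
open import Function using (_∘_)
open import Level using (0ℓ)
import Relation.Binary.PropositionalEquality as ≡
open ≡ using (_≡_; _≢_)
open import Relation.Nullary using (¬_; contradiction)

-- Andrews' series has the denominators (p;p)_n (x p^n;p)_∞, and the commutative semiring in which
-- the proof computes has no division. At x = p^(j+1) they divide (p;p)_∞, and the quotient is a
-- product of only j factors; this is why x runs through powers of p and why a factor (p;p)_∞
-- separates the series from the D_j.
--
-- The recursion removes one part size at a time, through an intermediate family with parts at least
-- 2j, fewer than i of them equal to 2j. This family is Andrews' H, just as D_j is J. Removing 2j+1,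
-- which occurs at most once, is the definition J_i(x) = H_i(xp) + xq H_(i-1)(xp). Allowing one more
-- copy of 2j is H_(i+1)(x) - H_i(x) = x^i J_(k-i)(x), because i copies of 2j leave room for fewer
-- than k - i parts equal to 2j+1 or 2j+2.

module BigOperator (M : CommutativeMonoid 0ℓ 0ℓ) where
  open CommutativeMonoid M
  open import Relation.Binary.Reasoning.Setoid setoid
  open import Algebra.Properties.CommutativeSemigroup commutativeSemigroup using (interchange)

  big : ℕ → (ℕ → Carrier) → Carrier
  big zero    f = ε
  big (suc n) f = f 0 ∙ big n (f ∘ suc)

  big-cong : ∀ n {f g} → (∀ m → m ℕ.< n → f m ≈ g m) → big n f ≈ big n g
  big-cong zero    f≈g = refl
  big-cong (suc n) f≈g = ∙-cong (f≈g 0 (s≤s z≤n)) (big-cong n λ m m<n → f≈g (suc m) (s≤s m<n))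

  big-distrib : ∀ n f g → big n (λ m → f m ∙ g m) ≈ big n f ∙ big n g
  big-distrib zero    f g = sym (identityˡ ε)
  big-distrib (suc n) f g = trans (∙-congˡ (big-distrib n (f ∘ suc) (g ∘ suc))) (interchange _ _ _ _)

  big-ε : ∀ n {f} → (∀ m → m ℕ.< n → f m ≈ ε) → big n f ≈ ε
  big-ε zero    f≈ε = refl
  big-ε (suc n) f≈ε = trans (∙-cong (f≈ε 0 (s≤s z≤n)) (big-ε n λ m m<n → f≈ε (suc m) (s≤s m<n))) (identityˡ ε)

  big-+ : ∀ m n f → big (m ℕ.+ n) f ≈ big m f ∙ big n (λ r → f (m ℕ.+ r))
  big-+ zero    n f = sym (identityˡ _)
  big-+ (suc m) n f = trans (∙-congˡ (big-+ m n (f ∘ suc))) (sym (assoc _ _ _))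

  big-last : ∀ n f → big (suc n) f ≈ big n f ∙ f n
  big-last zero    f = trans (identityʳ _) (sym (identityˡ _))
  big-last (suc n) f = trans (∙-congˡ (big-last n (f ∘ suc))) (sym (assoc _ _ _))

  -- The sums and products below are infinite ones cut off at a fixed length. Shifting the index by
  -- one would lengthen them; the extra last term is trivial, in each use by nilpotency.
  big-shift : ∀ n f → f n ≈ ε → f 0 ∙ big n (f ∘ suc) ≈ big n f
  big-shift n f fn≈ε = trans (big-last n f) (trans (∙-congˡ fn≈ε) (identityʳ _))

  big-support : ∀ m n f → (∀ r → m ℕ.≤ r → f r ≈ ε) → big (m ℕ.+ n) f ≈ big m f
  big-support m n f f≈ε =
    trans (big-+ m n f) (trans (∙-congˡ (big-ε n λ r _ → f≈ε (m ℕ.+ r) (ℕₚ.m≤m+n m r))) (identityʳ _))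

-- s plays the role of -1: with negation encoded as a constant of a semiring, the natural-coefficient solver applies.
module SignedSemiring (R : CommutativeSemiring 0ℓ 0ℓ)
  (s : CommutativeSemiring.Carrier R)
  (1+s≈0 : CommutativeSemiring._≈_ R (CommutativeSemiring._+_ R (CommutativeSemiring.1# R) s) (CommutativeSemiring.0# R))
  where

  open CommutativeSemiring R public
  open import Relation.Binary.Reasoning.Setoid setoid
  open import Algebra.Properties.Semiring.Exp semiring
    using (_^_; ^-homo-*; ^-assocʳ; ^-congˡ) public
  open import Algebra.Properties.CommutativeSemiring.Exp R using (^-distrib-*) public
  open import Algebra.Solver.Ring.NaturalCoefficients.Default R using (solve; _:=_; _:+_; _:*_; con)

  open BigOperator +-commutativeMonoid public renaming
    (big to ∑; big-cong to ∑-cong; big-distrib to ∑-+; big-ε to ∑-0; big-last to ∑-last;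
     big-shift to ∑-shift; big-+ to ∑-split; big-support to ∑-support)
  open BigOperator *-commutativeMonoid public renaming
    (big to ∏; big-cong to ∏-cong; big-distrib to ∏-*; big-ε to ∏-1; big-last to ∏-last;
     big-shift to ∏-shift; big-+ to ∏-split; big-support to ∏-support)

  ∑-*ˡ : ∀ n c f → c * ∑ n f ≈ ∑ n (λ m → c * f m)
  ∑-*ˡ zero    c f = zeroʳ c
  ∑-*ˡ (suc n) c f = trans (distribˡ _ _ _) (+-congˡ (∑-*ˡ n c (f ∘ suc)))

  x+sx≈0 : ∀ x → x + s * x ≈ 0#
  x+sx≈0 x = begin
    x + s * x    ≈⟨ solve 2 (λ x s → x :+ s :* x := (con 1 :+ s) :* x) refl x s ⟩
    (1# + s) * x ≈⟨ *-congʳ 1+s≈0 ⟩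
    0# * x       ≈⟨ zeroˡ x ⟩
    0#           ∎

  +-cancelʳ : ∀ z {x y} → x + z ≈ y + z → x ≈ y
  +-cancelʳ z {x} {y} x+z≈y+z = begin
    x               ≈⟨ +-identityʳ x ⟨
    x + 0#          ≈⟨ +-congˡ (x+sx≈0 z) ⟨
    x + (z + s * z) ≈⟨ +-assoc _ _ _ ⟨
    x + z + s * z   ≈⟨ +-congʳ x+z≈y+z ⟩
    y + z + s * z   ≈⟨ +-assoc _ _ _ ⟩
    y + (z + s * z) ≈⟨ +-congˡ (x+sx≈0 z) ⟩
    y + 0#          ≈⟨ +-identityʳ y ⟩
    y               ∎

  move-s : ∀ x y z → x ≈ y + z → s * x + z ≈ s * y
  move-s x y z x≈y+z = begin
    s * x + z            ≈⟨ +-congʳ (*-congˡ x≈y+z) ⟩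
    s * (y + z) + z      ≈⟨ solve 3 (λ s y z → s :* (y :+ z) :+ z := s :* y :+ (z :+ s :* z)) refl s y z ⟩
    s * y + (z + s * z)  ≈⟨ +-congˡ (x+sx≈0 z) ⟩
    s * y + 0#           ≈⟨ +-identityʳ _ ⟩
    s * y                ∎

  infix 9 1-_
  1-_ : Carrier → Carrier
  1- x = 1# + s * x

  -- The source of the q-difference steps: when y is a product and 1 - x the factor adjacent to it,
  -- the first summand is the extended product, and no subtraction has to be written.
  y≈[1-x]y+xy : ∀ x y → y ≈ 1- x * y + x * y
  y≈[1-x]y+xy x y = sym (begin
    (1# + s * x) * y + x * y  ≈⟨ solve 3 (λ s x y → (con 1 :+ s :* x) :* y :+ x :* y := y :+ (x :+ s :* x) :* y) refl s x y ⟩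
    y + (x + s * x) * y       ≈⟨ +-congˡ (trans (*-congʳ (x+sx≈0 x)) (zeroˡ y)) ⟩
    y + 0#                    ≈⟨ +-identityʳ y ⟩
    y                         ∎)

  ^-zero : ∀ {z N} → z ^ N ≈ 0# → ∀ m → N ℕ.≤ m → z ^ m ≈ 0#
  ^-zero {z} {N} z^N≈0 m N≤m = begin
    z ^ m                   ≡⟨ ≡.cong (z ^_) (ℕₚ.m+[n∸m]≡n N≤m) ⟨
    z ^ (N ℕ.+ (m ℕ.∸ N))   ≈⟨ ^-homo-* z N (m ℕ.∸ N) ⟩
    z ^ N * z ^ (m ℕ.∸ N)   ≈⟨ *-congʳ z^N≈0 ⟩
    0# * z ^ (m ℕ.∸ N)      ≈⟨ zeroˡ _ ⟩
    0#                      ∎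

  *-^-zero : ∀ {z N} y → z ^ N ≈ 0# → (z * y) ^ N ≈ 0#
  *-^-zero {z} {N} y z^N≈0 = trans (^-distrib-* z y N) (trans (*-congʳ z^N≈0) (zeroˡ _))

  1+0*x : ∀ {x} y → x ≈ 0# → 1# + y * x ≈ 1#
  1+0*x y x≈0 = trans (+-congˡ (trans (*-congˡ x≈0) (zeroʳ y))) (+-identityʳ 1#)

  module Tail (N : ℕ) (f : ℕ → Carrier) (f≈1 : ∀ m → N ℕ.≤ m → f m ≈ 1#) where
    -- The infinite product of f from index t on. It keeps N factors for every t instead of stopping
    -- at index N, so that `tail-step` needs no case distinction.
    tail : ℕ → Carrier
    tail t = ∏ N (λ m → f (t ℕ.+ m))

    tail-step : ∀ t → tail t ≈ f t * tail (suc t)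
    tail-step t = begin
      tail t                                        ≈⟨ ∏-shift N g (f≈1 _ (ℕₚ.m≤n+m N t)) ⟨
      f (t ℕ.+ 0) * ∏ N (λ m → f (t ℕ.+ suc m))     ≈⟨ *-cong (reflexive (≡.cong f (ℕₚ.+-identityʳ t)))
                                                         (∏-cong N λ m _ → reflexive (≡.cong f (ℕₚ.+-suc t m))) ⟩
      f t * tail (suc t)                            ∎
      where
      g : ℕ → Carrier
      g m = f (t ℕ.+ m)

    tail-1 : ∀ t → N ℕ.≤ t → tail t ≈ 1#
    tail-1 t N≤t = ∏-1 N λ m _ → f≈1 _ (ℕₚ.≤-trans N≤t (ℕₚ.m≤m+n t m))

    ∏*tail : ∀ t → ∏ t f * tail t ≈ tail 0
    ∏*tail zero = *-identityˡ _
    ∏*tail (suc t) = begin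
      ∏ (suc t) f * tail (suc t)    ≈⟨ *-congʳ (∏-last t f) ⟩
      ∏ t f * f t * tail (suc t)    ≈⟨ *-assoc _ _ _ ⟩
      ∏ t f * (f t * tail (suc t))  ≈⟨ *-congˡ (tail-step t) ⟨
      ∏ t f * tail t                ≈⟨ ∏*tail t ⟩
      tail 0                        ∎

    ∏≈tail : ∀ t → N ℕ.≤ t → ∏ t f ≈ tail 0
    ∏≈tail t N≤t = trans (sym (*-identityʳ _)) (trans (*-congˡ (sym (tail-1 t N≤t))) (∏*tail t))

-- The Jacobi triple product with nilpotent variables

module JacobiTripleProduct (R : CommutativeSemiring 0ℓ 0ℓ)
  (s : CommutativeSemiring.Carrier R)
  (1+s≈0 : CommutativeSemiring._≈_ R (CommutativeSemiring._+_ R (CommutativeSemiring.1# R) s) (CommutativeSemiring.0# R))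
  where

  open SignedSemiring R s 1+s≈0
  open import Relation.Binary.Reasoning.Setoid setoid
  open import Algebra.Solver.Ring.NaturalCoefficients.Default R using (solve; _:=_; _:+_; _:*_; con)

  module _ (z w : Carrier) (N : ℕ) (z^N≈0 : z ^ N ≈ 0#) (w^N≈0 : w ^ N ≈ 0#) where

    Q : Carrier
    Q = z * w

    -- y^n Q^(n(n-1)/2)
    triangular : Carrier → ℕ → Carrier
    triangular y zero    = 1#
    triangular y (suc n) = y * Q ^ n * triangular y n

    triangular-zero : ∀ {y} → y ^ N ≈ 0# → ∀ n → N ℕ.≤ n → triangular y n ≈ 0#
    triangular-zero {y} y^N≈0 n N≤n = begin
      triangular y n               ≈⟨ factor n ⟩
      y ^ n * triangular 1# n      ≈⟨ *-congʳ (^-zero y^N≈0 n N≤n) ⟩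
      0# * triangular 1# n         ≈⟨ zeroˡ _ ⟩
      0#                           ∎
      where
      factor : ∀ n → triangular y n ≈ y ^ n * triangular 1# n
      factor zero    = sym (*-identityˡ 1#)
      factor (suc n) = begin
        y * Q ^ n * triangular y n                   ≈⟨ *-congˡ (factor n) ⟩
        y * Q ^ n * (y ^ n * triangular 1# n)        ≈⟨ solve 4 (λ y a b c → y :* a :* (b :* c) := y :* b :* (con 1 :* a :* c)) refl y (Q ^ n) (y ^ n) (triangular 1# n) ⟩
        y * y ^ n * (1# * Q ^ n * triangular 1# n)   ∎

    Q^N≈0 : Q ^ N ≈ 0#
    Q^N≈0 = *-^-zero {z} {N} w z^N≈0

    -- `d t` is (Q^(t+1);Q)_∞, that is (Q;Q)_∞ / (Q;Q)_t: the reciprocals 1 / (Q;Q)_t of the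
    -- q-series below, cleared by the factor `d 0`.
    open Tail N (λ m → 1- (Q ^ suc m)) (λ m N≤m → 1+0*x s (^-zero Q^N≈0 (suc m) (ℕₚ.m≤n⇒m≤1+n N≤m)))
      using () renaming (tail to d; tail-step to d-step; tail-1 to d-1)

    d-suc : ∀ t → d (suc t) ≈ d t + Q ^ suc t * d (suc t)
    d-suc t = trans (y≈[1-x]y+xy (Q ^ suc t) (d (suc t))) (+-congʳ (sym (d-step t)))

    zQ-cancel : ∀ A m → Q ^ A * z * (w * Q ^ m) ≈ Q ^ suc (A ℕ.+ m)
    zQ-cancel A m = begin
      Q ^ A * z * (w * Q ^ m)  ≈⟨ solve 4 (λ a z w b → a :* z :* (w :* b) := z :* w :* (a :* b)) refl (Q ^ A) z w (Q ^ m) ⟩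
      Q * (Q ^ A * Q ^ m)      ≈⟨ *-congˡ (^-homo-* Q A m) ⟨
      Q * Q ^ (A ℕ.+ m)        ∎

    -- ∑_{r ≤ A} triangular z (n + r) d(A - r)
    nonnegative : ℕ → ℕ → Carrier
    nonnegative n zero    = triangular z n * d 0
    nonnegative n (suc A) = triangular z n * d (suc A) + nonnegative (suc n) A

    negative : ℕ → Carrier
    negative A = ∑ N (λ m → triangular w (suc m) * d (A ℕ.+ suc m))

    -- In the term r ≤ A write d(A+1-r) = d(A-r) + Q^(A+1-r) d(A+1-r). For r ≥ 1 the second part
    -- times `triangular z` at n + r is z Q^(n+A) times the term r - 1 of the old sum, and so is the
    -- whole term r = A + 1. Only r = 0 leaves a remainder.
    nonnegative-step : ∀ n A → nonnegative n (suc A) ≈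
      Q ^ suc A * triangular z n * d (suc A) + (1# + z * Q ^ (n ℕ.+ A)) * nonnegative n A
    nonnegative-step n zero = begin
      e * d 1 + z * Q ^ n * e * d 0                      ≈⟨ +-congʳ (*-congˡ (d-suc 0)) ⟩
      e * (d 0 + Q * 1# * d 1) + z * Q ^ n * e * d 0     ≈⟨ solve 6 (λ e d₀ d₁ q z qn → e :* (d₀ :+ q :* d₁) :+ z :* qn :* e :* d₀
                                                              := q :* e :* d₁ :+ (con 1 :+ z :* qn) :* (e :* d₀)) refl e (d 0) (d 1) (Q * 1#) z (Q ^ n) ⟩
      Q * 1# * e * d 1 + (1# + z * Q ^ n) * (e * d 0)    ≈⟨ +-congˡ (*-congʳ (+-congˡ (*-congˡ (reflexive (≡.cong (Q ^_) (≡.sym (ℕₚ.+-identityʳ n))))))) ⟩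
      Q * 1# * e * d 1 + (1# + z * Q ^ (n ℕ.+ 0)) * (e * d 0) ∎
      where
      e : Carrier
      e = triangular z n
    nonnegative-step n (suc A) = begin
      e * d (2 ℕ.+ A) + nonnegative (suc n) (suc A)
        ≈⟨ +-cong (*-congˡ (d-suc (suc A))) (nonnegative-step (suc n) A) ⟩
      e * (d (suc A) + Q ^ (2 ℕ.+ A) * d (2 ℕ.+ A)) + (Q ^ suc A * (z * Q ^ n * e) * d (suc A) + (1# + z * Q ^ suc (n ℕ.+ A)) * nonnegative (suc n) A)
        ≈⟨ +-congˡ (+-congʳ (*-congʳ (trans (solve 4 (λ a z b e → a :* (z :* b :* e) := z :* (b :* a) :* e) refl (Q ^ suc A) z (Q ^ n) e) (*-congʳ (*-congˡ Q^n*Q^[1+A]))))) ⟩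
      e * (d (suc A) + Q ^ (2 ℕ.+ A) * d (2 ℕ.+ A)) + (z * Q ^ suc (n ℕ.+ A) * e * d (suc A) + (1# + z * Q ^ suc (n ℕ.+ A)) * nonnegative (suc n) A)
        ≈⟨ solve 6 (λ e d₁ x y v u → e :* (d₁ :+ x) :+ (y :* e :* d₁ :+ (con 1 :+ y) :* v) := e :* x :+ (con 1 :+ y) :* (e :* d₁ :+ v))
             refl e (d (suc A)) (Q ^ (2 ℕ.+ A) * d (2 ℕ.+ A)) (z * Q ^ suc (n ℕ.+ A)) (nonnegative (suc n) A) 0# ⟩
      e * (Q ^ (2 ℕ.+ A) * d (2 ℕ.+ A)) + (1# + z * Q ^ suc (n ℕ.+ A)) * (e * d (suc A) + nonnegative (suc n) A)
        ≈⟨ +-cong (solve 3 (λ e a b → e :* (a :* b) := a :* e :* b) refl e (Q ^ (2 ℕ.+ A)) (d (2 ℕ.+ A)))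
             (*-congʳ (+-congˡ (*-congˡ (reflexive (≡.cong (Q ^_) (≡.sym (ℕₚ.+-suc n A))))))) ⟩
      Q ^ (2 ℕ.+ A) * e * d (2 ℕ.+ A) + (1# + z * Q ^ (n ℕ.+ suc A)) * (e * d (suc A) + nonnegative (suc n) A) ∎
      where
      e : Carrier
      e = triangular z n
      Q^n*Q^[1+A] : Q ^ n * Q ^ suc A ≈ Q ^ suc (n ℕ.+ A)
      Q^n*Q^[1+A] = trans (sym (^-homo-* Q n (suc A))) (reflexive (≡.cong (Q ^_) (ℕₚ.+-suc n A)))

    zQ*negative : ∀ A → z * Q ^ A * negative A ≈ ∑ N (λ m → Q ^ suc (A ℕ.+ m) * triangular w m * d (A ℕ.+ suc m))
    zQ*negative A = trans (∑-*ˡ N _ _) (∑-cong N λ m _ → begin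
      z * Q ^ A * (w * Q ^ m * triangular w m * d (A ℕ.+ suc m))
        ≈⟨ solve 6 (λ z a w b e d → z :* a :* (w :* b :* e :* d) := a :* z :* (w :* b) :* e :* d) refl z (Q ^ A) w (Q ^ m) (triangular w m) (d (A ℕ.+ suc m)) ⟩
      Q ^ A * z * (w * Q ^ m) * triangular w m * d (A ℕ.+ suc m)
        ≈⟨ *-congʳ (*-congʳ (zQ-cancel A m)) ⟩
      Q ^ suc (A ℕ.+ m) * triangular w m * d (A ℕ.+ suc m) ∎)

    -- The termwise argument of `nonnegative-step`, with z w = Q lowering the index of
    -- `triangular w`. The second summand on the left is the remainder that the nonnegative half
    -- leaves at n = 0; here it becomes the first term of the shifted sum.
    negative-step : ∀ A → negative (suc A) + Q ^ suc A * d (suc A) ≈ (1# + z * Q ^ A) * negative A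
    negative-step A = begin
      negative (suc A) + Q ^ suc A * d (suc A)
        ≈⟨ +-cong (∑-cong N λ m _ → trans (*-congˡ (d-suc (A ℕ.+ suc m))) (trans (distribˡ _ _ _) (+-congˡ (rearrange m))))
             (trans (solve 2 (λ a b → a :* b := a :* con 1 :* b) refl (Q ^ suc A) (d (suc A)))
               (*-cong (*-congʳ (reflexive (≡.cong (λ t → Q ^ suc t) (≡.sym (ℕₚ.+-identityʳ A))))) (reflexive (≡.cong d (≡.sym (ℕₚ.+-comm A 1)))))) ⟩
      ∑ N (λ m → triangular w (suc m) * d (A ℕ.+ suc m) + f (suc m)) + f 0
        ≈⟨ +-congʳ (∑-+ N _ _) ⟩
      negative A + ∑ N (λ m → f (suc m)) + f 0
        ≈⟨ solve 3 (λ a b c → a :+ b :+ c := a :+ (c :+ b)) refl (negative A) (∑ N (λ m → f (suc m))) (f 0) ⟩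
      negative A + (f 0 + ∑ N (λ m → f (suc m)))
        ≈⟨ +-congˡ (∑-shift N f fN≈0) ⟩
      negative A + ∑ N f
        ≈⟨ +-congˡ (zQ*negative A) ⟨
      negative A + z * Q ^ A * negative A
        ≈⟨ solve 2 (λ a b → a :+ b :* a := (con 1 :+ b) :* a) refl (negative A) (z * Q ^ A) ⟩
      (1# + z * Q ^ A) * negative A ∎
      where
      f : ℕ → Carrier
      f m = Q ^ suc (A ℕ.+ m) * triangular w m * d (A ℕ.+ suc m)
      fN≈0 : f N ≈ 0#
      fN≈0 = trans (*-congʳ (trans (*-congˡ (triangular-zero w^N≈0 N ℕₚ.≤-refl)) (zeroʳ _))) (zeroˡ _)
      rearrange : ∀ m → triangular w (suc m) * (Q ^ suc (A ℕ.+ suc m) * d (suc (A ℕ.+ suc m))) ≈ f (suc m)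
      rearrange m = trans (solve 3 (λ e a b → e :* (a :* b) := a :* e :* b) refl (triangular w (suc m)) (Q ^ suc (A ℕ.+ suc m)) (d (suc (A ℕ.+ suc m))))
        (*-congˡ (reflexive (≡.cong d (≡.sym (ℕₚ.+-suc A (suc m))))))

    -- partial (suc A) = (1 + z Q^A) partial A, and partial A is theta for large A, so partial 0 times the product
    -- of all 1 + z Q^m is theta; the factors 1 + w Q^m are split off partial 0 = euler 0 in the same way.
    partial : ℕ → Carrier
    partial A = nonnegative 0 A + negative A

    partial-step : ∀ A → partial (suc A) ≈ (1# + z * Q ^ A) * partial A
    partial-step A = begin
      nonnegative 0 (suc A) + negative (suc A)
        ≈⟨ +-congʳ (nonnegative-step 0 A) ⟩
      Q ^ suc A * 1# * d (suc A) + (1# + z * Q ^ A) * nonnegative 0 A + negative (suc A)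
        ≈⟨ solve 4 (λ a b c d → a :* con 1 :* b :+ c :+ d := c :+ (d :+ a :* b)) refl (Q ^ suc A) (d (suc A)) ((1# + z * Q ^ A) * nonnegative 0 A) (negative (suc A)) ⟩
      (1# + z * Q ^ A) * nonnegative 0 A + (negative (suc A) + Q ^ suc A * d (suc A))
        ≈⟨ +-congˡ (negative-step A) ⟩
      (1# + z * Q ^ A) * nonnegative 0 A + (1# + z * Q ^ A) * negative A
        ≈⟨ distribˡ _ _ _ ⟨
      (1# + z * Q ^ A) * partial A ∎

    partial-product : ∀ A → partial A ≈ ∏ A (λ m → 1# + z * Q ^ m) * partial 0
    partial-product zero    = sym (*-identityˡ _)
    partial-product (suc A) = begin
      partial (suc A)                                                   ≈⟨ partial-step A ⟩
      (1# + z * Q ^ A) * partial A                                      ≈⟨ *-congˡ (partial-product A) ⟩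
      (1# + z * Q ^ A) * (∏ A (λ m → 1# + z * Q ^ m) * partial 0)       ≈⟨ solve 3 (λ a b c → a :* (b :* c) := b :* a :* c) refl (1# + z * Q ^ A) (∏ A (λ m → 1# + z * Q ^ m)) (partial 0) ⟩
      ∏ A (λ m → 1# + z * Q ^ m) * (1# + z * Q ^ A) * partial 0         ≈⟨ *-congʳ (∏-last A (λ m → 1# + z * Q ^ m)) ⟨
      ∏ (suc A) (λ m → 1# + z * Q ^ m) * partial 0                      ∎

    theta : Carrier
    theta = ∑ N (triangular z) + ∑ N (λ m → triangular w (suc m))

    -- The length 2N splits as N + N: the first N terms carry `d` at indices above N, where it is 1,
    -- and the remaining terms contain z^N = 0.
    partial-limit : partial (N ℕ.+ N) ≈ theta
    partial-limit = +-cong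
      (trans (nonnegative-limit 0 N) (trans (+-congˡ (nonnegative-0 N N ℕₚ.≤-refl)) (+-identityʳ _)))
      (∑-cong N λ m _ → trans (*-congˡ (d-1 _ (ℕₚ.≤-trans (ℕₚ.m≤m+n N N) (ℕₚ.m≤m+n (N ℕ.+ N) (suc m))))) (*-identityʳ _))
      where
      nonnegative-0 : ∀ n A → N ℕ.≤ n → nonnegative n A ≈ 0#
      nonnegative-0 n zero    N≤n = trans (*-congʳ (triangular-zero z^N≈0 n N≤n)) (zeroˡ _)
      nonnegative-0 n (suc A) N≤n = trans (+-cong (trans (*-congʳ (triangular-zero z^N≈0 n N≤n)) (zeroˡ _)) (nonnegative-0 (suc n) A (ℕₚ.m≤n⇒m≤1+n N≤n))) (+-identityˡ 0#)
      nonnegative-limit : ∀ n A → nonnegative n (A ℕ.+ N) ≈ ∑ A (λ m → triangular z (n ℕ.+ m)) + nonnegative (n ℕ.+ A) N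
      nonnegative-limit n zero = trans (reflexive (≡.cong (λ t → nonnegative t N) (≡.sym (ℕₚ.+-identityʳ n)))) (sym (+-identityˡ _))
      nonnegative-limit n (suc A) = begin
        triangular z n * d (suc (A ℕ.+ N)) + nonnegative (suc n) (A ℕ.+ N)
          ≈⟨ +-cong (trans (*-congˡ (d-1 _ (ℕₚ.m≤n⇒m≤1+n (ℕₚ.m≤n+m N A)))) (trans (*-identityʳ _) (reflexive (≡.cong (triangular z) (≡.sym (ℕₚ.+-identityʳ n)))))) (nonnegative-limit (suc n) A) ⟩
        triangular z (n ℕ.+ 0) + (∑ A (λ m → triangular z (suc n ℕ.+ m)) + nonnegative (suc n ℕ.+ A) N)
          ≈⟨ +-assoc _ _ _ ⟨
        triangular z (n ℕ.+ 0) + ∑ A (λ m → triangular z (suc n ℕ.+ m)) + nonnegative (suc n ℕ.+ A) N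
          ≈⟨ +-cong (+-congˡ (∑-cong A λ m _ → reflexive (≡.cong (triangular z) (≡.sym (ℕₚ.+-suc n m))))) (reflexive (≡.cong (λ t → nonnegative t N) (≡.sym (ℕₚ.+-suc n A)))) ⟩
        ∑ (suc A) (λ m → triangular z (n ℕ.+ m)) + nonnegative (n ℕ.+ suc A) N ∎

    -- Euler's series ∑ y^m Q^(m(m-1)/2) / (Q;Q)_m = ∏ (1 + y Q^m) at y = w Q^B, multiplied by
    -- (Q;Q)_∞. `euler-step` is its functional equation F(y) = (1 + y) F(yQ).
    euler : ℕ → Carrier
    euler B = ∑ N (λ m → Q ^ (B ℕ.* m) * triangular w m * d m)

    euler-step : ∀ B → euler B ≈ (1# + w * Q ^ B) * euler (suc B)
    euler-step B = begin
      euler B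
        ≈⟨ ∑-shift N f (trans (*-congʳ (trans (*-congˡ (triangular-zero w^N≈0 N ℕₚ.≤-refl)) (zeroʳ _))) (zeroˡ _)) ⟨
      f 0 + ∑ N (λ m → f (suc m))
        ≈⟨ +-cong (trans (*-congʳ (*-congʳ (reflexive (≡.cong (Q ^_) (ℕₚ.*-zeroʳ B))))) (sym (trans (*-congʳ (*-congʳ (reflexive (≡.cong (Q ^_) (ℕₚ.*-zeroʳ (suc B)))))) refl)))
             (∑-cong N λ m _ → main m) ⟩
      g 0 + ∑ N (λ m → w * Q ^ B * g m + g (suc m))
        ≈⟨ +-congˡ (trans (∑-+ N _ _) (+-congʳ (sym (∑-*ˡ N _ _)))) ⟩
      g 0 + (w * Q ^ B * ∑ N g + ∑ N (λ m → g (suc m)))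
        ≈⟨ solve 3 (λ a b c → a :+ (b :+ c) := b :+ (a :+ c)) refl (g 0) (w * Q ^ B * ∑ N g) (∑ N (λ m → g (suc m))) ⟩
      w * Q ^ B * ∑ N g + (g 0 + ∑ N (λ m → g (suc m)))
        ≈⟨ +-congˡ (∑-shift N g (trans (*-congʳ (trans (*-congˡ (triangular-zero w^N≈0 N ℕₚ.≤-refl)) (zeroʳ _))) (zeroˡ _))) ⟩
      w * Q ^ B * ∑ N g + ∑ N g
        ≈⟨ solve 2 (λ a b → a :* b :+ b := (con 1 :+ a) :* b) refl (w * Q ^ B) (∑ N g) ⟩
      (1# + w * Q ^ B) * euler (suc B) ∎
      where
      f g : ℕ → Carrier
      f m = Q ^ (B ℕ.* m) * triangular w m * d m
      g m = Q ^ (suc B ℕ.* m) * triangular w m * d m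
      main : ∀ m → f (suc m) ≈ w * Q ^ B * g m + g (suc m)
      main m = begin
        Q ^ (B ℕ.* suc m) * E * d (suc m)
          ≈⟨ *-congˡ (y≈[1-x]y+xy (Q ^ suc m) (d (suc m))) ⟩
        Q ^ (B ℕ.* suc m) * E * (1- (Q ^ suc m) * d (suc m) + Q ^ suc m * d (suc m))
          ≈⟨ *-congˡ (+-congʳ (d-step m)) ⟨
        Q ^ (B ℕ.* suc m) * E * (d m + Q ^ suc m * d (suc m))
          ≈⟨ solve 5 (λ a e x y z → a :* e :* (x :+ y :* z) := a :* e :* x :+ y :* a :* e :* z) refl (Q ^ (B ℕ.* suc m)) E (d m) (Q ^ suc m) (d (suc m)) ⟩
        Q ^ (B ℕ.* suc m) * (w * Q ^ m * triangular w m) * d m + Q ^ suc m * Q ^ (B ℕ.* suc m) * E * d (suc m)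
          ≈⟨ +-cong (*-congʳ (trans (*-congʳ (trans (reflexive (≡.cong (Q ^_) (ℕₚ.*-suc B m))) (^-homo-* Q B (B ℕ.* m))))
                (trans (solve 5 (λ a b w c t → a :* b :* (w :* c :* t) := w :* a :* (c :* b :* t)) refl (Q ^ B) (Q ^ (B ℕ.* m)) w (Q ^ m) (triangular w m))
                  (*-congˡ (*-congʳ (sym (^-homo-* Q m (B ℕ.* m))))))))
              (*-congʳ (*-congʳ (sym (^-homo-* Q (suc m) (B ℕ.* suc m))))) ⟩
        w * Q ^ B * (Q ^ (suc B ℕ.* m) * triangular w m) * d m + g (suc m)
          ≈⟨ +-congʳ (*-assoc _ _ _) ⟩
        w * Q ^ B * g m + g (suc m) ∎
        where
        E : Carrier
        E = triangular w (suc m)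

    euler-product : ∀ B → euler 0 ≈ ∏ B (λ m → 1# + w * Q ^ m) * euler B
    euler-product zero    = sym (*-identityˡ _)
    euler-product (suc B) = begin
      euler 0                                                             ≈⟨ euler-product B ⟩
      ∏ B (λ m → 1# + w * Q ^ m) * euler B                                ≈⟨ *-congˡ (euler-step B) ⟩
      ∏ B (λ m → 1# + w * Q ^ m) * ((1# + w * Q ^ B) * euler (suc B))     ≈⟨ *-assoc _ _ _ ⟨
      ∏ B (λ m → 1# + w * Q ^ m) * (1# + w * Q ^ B) * euler (suc B)       ≈⟨ *-congʳ (∏-last B (λ m → 1# + w * Q ^ m)) ⟨
      ∏ (suc B) (λ m → 1# + w * Q ^ m) * euler (suc B)                    ∎

    euler-limit : euler N ≈ d 0
    euler-limit = begin
      euler N                            ≈⟨ ∑-shift N f (trans (*-congʳ (trans (*-congˡ (triangular-zero w^N≈0 N ℕₚ.≤-refl)) (zeroʳ _))) (zeroˡ _)) ⟨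
      f 0 + ∑ N (λ m → f (suc m))        ≈⟨ +-cong (trans (*-congʳ (trans (*-identityʳ _) (reflexive (≡.cong (Q ^_) (ℕₚ.*-zeroʳ N))))) (*-identityˡ _))
                                              (∑-0 N λ m _ → trans (*-congʳ (trans (*-congʳ (^-zero Q^N≈0 (N ℕ.* suc m) (ℕₚ.m≤m*n N (suc m)))) (zeroˡ _))) (zeroˡ _)) ⟩
      d 0 + 0#                           ≈⟨ +-identityʳ _ ⟩
      d 0                                ∎
      where
      f : ℕ → Carrier
      f m = Q ^ (N ℕ.* m) * triangular w m * d m

    partial-0 : partial 0 ≈ euler 0
    partial-0 = trans (+-cong (sym (*-congʳ (*-identityˡ 1#))) (∑-cong N λ m _ → sym (*-congʳ (*-identityˡ _))))
      (∑-shift N (λ m → 1# * triangular w m * d m) (trans (*-congʳ (trans (*-congˡ (triangular-zero w^N≈0 N ℕₚ.≤-refl)) (zeroʳ _))) (zeroˡ _)))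

    jacobi-triple-product :
      theta ≈ ∏ N (λ m → 1- (Q ^ suc m)) * ∏ N (λ m → 1# + z * Q ^ m) * ∏ N (λ m → 1# + w * Q ^ m)
    jacobi-triple-product = begin
      theta
        ≈⟨ partial-limit ⟨
      partial (N ℕ.+ N)
        ≈⟨ partial-product (N ℕ.+ N) ⟩
      ∏ (N ℕ.+ N) (λ m → 1# + z * Q ^ m) * partial 0
        ≈⟨ *-cong (∏-support N N _ λ m N≤m → 1+0*x z (^-zero Q^N≈0 m N≤m))
             (trans partial-0 (trans (euler-product N) (*-congˡ euler-limit))) ⟩
      ∏ N (λ m → 1# + z * Q ^ m) * (∏ N (λ m → 1# + w * Q ^ m) * d 0)
        ≈⟨ solve 3 (λ a b c → a :* (b :* c) := c :* a :* b) refl (∏ N (λ m → 1# + z * Q ^ m)) (∏ N (λ m → 1# + w * Q ^ m)) (d 0) ⟩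
      d 0 * ∏ N (λ m → 1# + z * Q ^ m) * ∏ N (λ m → 1# + w * Q ^ m) ∎

-- Andrews' series at powers of p: recursion, vanishing argument, and theta series at x = 1

module ThetaQuotients (R : CommutativeSemiring 0ℓ 0ℓ)
  (s : CommutativeSemiring.Carrier R)
  (1+s≈0 : CommutativeSemiring._≈_ R (CommutativeSemiring._+_ R (CommutativeSemiring.1# R) s) (CommutativeSemiring.0# R))
  where

  open SignedSemiring R s 1+s≈0
  open JacobiTripleProduct R s 1+s≈0
  open import Relation.Binary.Reasoning.Setoid setoid
  open import Algebra.Solver.Ring.NaturalCoefficients.Default R using (solve; _:=_; _:+_; _:*_; con)

  module _ (q : Carrier) (N : ℕ) (q^N≈0 : q ^ N ≈ 0#) (k : ℕ) where

    p : Carrier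
    p = q * q

    p^≥N≈0 : ∀ m → N ℕ.≤ m → p ^ m ≈ 0#
    p^≥N≈0 = ^-zero (*-^-zero {q} {N} q q^N≈0)

    open Tail N (λ m → 1# + q * p ^ m) (λ m N≤m → 1+0*x q (p^≥N≈0 m N≤m)) public
      using () renaming (tail to odd-tail; tail-step to odd-tail-step; tail-1 to odd-tail-1; ∏*tail to odd-∏*tail; ∏≈tail to odd-∏≈tail)
    open Tail N (λ m → 1- (p ^ suc m)) (λ m N≤m → 1+0*x s (p^≥N≈0 (suc m) (ℕₚ.m≤n⇒m≤1+n N≤m))) public
      using () renaming (tail to even-tail; ∏≈tail to even-∏≈tail)

    -- (-1)^n x^(kn) p^(kn(n-1)) q^n at x = p^j
    τ : ℕ → ℕ → Carrier
    τ j zero    = 1#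
    τ j (suc n) = s * q * (p ^ j) ^ k * (p ^ n) ^ k * (p ^ n) ^ k * τ j n

    -- (p;p)_∞ / ((p;p)_n (x p^n;p)_∞) at x = p^(j+1).
    even-factor : ℕ → ℕ → Carrier
    even-factor j n = ∏ j (λ m → 1- (p ^ (suc n ℕ.+ m)))

    odd-init : ℕ → Carrier
    odd-init n = ∏ n (λ m → 1# + q * p ^ m)

    -- (1/a;p)_n (a x p^(n+1);p)_∞ at a = -1/q and x = p^(j+1).
    odd-factor : ℕ → ℕ → Carrier
    odd-factor j n = odd-init n * odd-tail (n ℕ.+ suc j)

    -- Andrews' summand contains p^(kn²-in) (1 - x^i p^(2in)); `α` and `β` are its two terms,
    -- without the sign. Writing c for k - i keeps the exponents natural: kn² - in = kn(n-1) + cn.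
    α : ℕ → ℕ → ℕ → Carrier
    α j c n = τ (suc j) n * (p ^ n) ^ c * even-factor j n * odd-factor j n

    β : ℕ → ℕ → ℕ → Carrier
    β j i n = τ (suc j) n * ((p ^ n) ^ k * (p ^ n) ^ i * (p ^ suc j) ^ i) * even-factor j n * odd-factor j n

    -- Andrews' H_{k,i}(-1/q; x; q²) at x = p^(j+1), with its denominators cleared and c = k - i
    H : ℕ → ℕ → ℕ → Carrier
    H j i c = ∑ N (α j c) + s * ∑ N (β j i)

    -- J_{k,i} at x = p^j, with i = i' + 1 and c = k - i
    J : ℕ → ℕ → ℕ → Carrier
    J j i′ c = H j (suc i′) c + p ^ j * q * H j i′ (suc c)

    τ-zero : ∀ j n → N ℕ.≤ n → τ j n ≈ 0#
    τ-zero j n N≤n = trans (factor n) (trans (*-congʳ (^-zero q^N≈0 n N≤n)) (zeroˡ _))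
      where
      rest : ℕ → Carrier
      rest zero    = 1#
      rest (suc n) = s * (p ^ j) ^ k * (p ^ n) ^ k * (p ^ n) ^ k * rest n
      factor : ∀ n → τ j n ≈ q ^ n * rest n
      factor zero    = sym (*-identityˡ 1#)
      factor (suc n) = trans (*-congˡ (factor n))
        (solve 6 (λ s q a b r t → s :* q :* a :* b :* b :* (t :* r) := q :* t :* (s :* a :* b :* b :* r)) refl s q ((p ^ j) ^ k) ((p ^ n) ^ k) (rest n) (q ^ n))

    τ-suc : ∀ j n → τ (suc j) n ≈ τ j n * (p ^ n) ^ k
    τ-suc j zero    = sym (trans (*-identityˡ _) (1^ k))
      where
      1^ : ∀ k → 1# ^ k ≈ 1#
      1^ zero    = refl
      1^ (suc k) = trans (*-identityˡ _) (1^ k)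
    τ-suc j (suc n) = begin
      s * q * (p * p ^ j) ^ k * K * K * τ (suc j) n       ≈⟨ *-cong (*-congʳ (*-congʳ (*-congˡ (^-distrib-* p (p ^ j) k)))) (τ-suc j n) ⟩
      s * q * (p ^ k * (p ^ j) ^ k) * K * K * (τ j n * K) ≈⟨ solve 6 (λ s q a b K t → s :* q :* (a :* b) :* K :* K :* (t :* K) := s :* q :* b :* K :* K :* t :* (a :* K)) refl s q (p ^ k) ((p ^ j) ^ k) K (τ j n) ⟩
      τ j (suc n) * (p ^ k * K)                           ≈⟨ *-congˡ (^-distrib-* p (p ^ n) k) ⟨
      τ j (suc n) * (p ^ suc n) ^ k                       ∎
      where
      K : Carrier
      K = (p ^ n) ^ k

    even-factor-suc : ∀ j n → even-factor j n ≈ even-factor (suc j) n + p ^ n * p ^ suc j * even-factor j n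
    even-factor-suc j n = trans (y≈[1-x]y+xy (p ^ n * p ^ suc j) (even-factor j n))
      (+-congʳ (trans (*-comm _ _) (trans (*-congˡ (+-congˡ (*-congˡ (trans (sym (^-homo-* p n (suc j))) (reflexive (≡.cong (p ^_) (ℕₚ.+-suc n j)))))))
        (sym (∏-last j (λ m → 1- (p ^ (suc n ℕ.+ m))))))))

    even-factor-shift : ∀ j n → even-factor j (suc n) ≈ even-factor (suc j) n + p ^ suc n * even-factor j (suc n)
    even-factor-shift j n = trans (y≈[1-x]y+xy (p ^ suc n) (even-factor j (suc n)))
      (+-congʳ (*-cong (+-congˡ (*-congˡ (reflexive (≡.cong (p ^_) (≡.sym (ℕₚ.+-identityʳ (suc n)))))))
        (∏-cong j λ m _ → +-congˡ (*-congˡ (reflexive (≡.cong (p ^_) (≡.sym (ℕₚ.+-suc (suc n) m))))))))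

    odd-factor-suc : ∀ j n → odd-factor j n ≈ (1# + q * (p ^ n * p ^ suc j)) * odd-factor (suc j) n
    odd-factor-suc j n = begin
      odd-init n * odd-tail (n ℕ.+ suc j)
        ≈⟨ *-congˡ (odd-tail-step (n ℕ.+ suc j)) ⟩
      odd-init n * ((1# + q * p ^ (n ℕ.+ suc j)) * odd-tail (suc (n ℕ.+ suc j)))
        ≈⟨ *-congˡ (*-cong (+-congˡ (*-congˡ (^-homo-* p n (suc j)))) (reflexive (≡.cong odd-tail (≡.sym (ℕₚ.+-suc n (suc j)))))) ⟩
      odd-init n * ((1# + q * (p ^ n * p ^ suc j)) * odd-tail (n ℕ.+ suc (suc j)))
        ≈⟨ solve 3 (λ a b c → a :* (b :* c) := b :* (a :* c)) refl (odd-init n) (1# + q * (p ^ n * p ^ suc j)) (odd-tail (n ℕ.+ suc (suc j))) ⟩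
      (1# + q * (p ^ n * p ^ suc j)) * odd-factor (suc j) n ∎

    odd-factor-shift : ∀ j n → odd-factor j (suc n) ≈ (1# + q * p ^ n) * odd-factor (suc j) n
    odd-factor-shift j n = begin
      odd-init (suc n) * odd-tail (suc n ℕ.+ suc j)
        ≈⟨ *-cong (∏-last n (λ m → 1# + q * p ^ m)) (reflexive (≡.cong odd-tail (≡.sym (ℕₚ.+-suc n (suc j))))) ⟩
      odd-init n * (1# + q * p ^ n) * odd-tail (n ℕ.+ suc (suc j))
        ≈⟨ solve 3 (λ a b c → a :* b :* c := b :* (a :* c)) refl (odd-init n) (1# + q * p ^ n) (odd-tail (n ℕ.+ suc (suc j))) ⟩
      (1# + q * p ^ n) * odd-factor (suc j) n ∎

    module _ (i c : ℕ) (i+1+c≡k : suc (i ℕ.+ c) ≡ k) (j : ℕ) where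

      X Xⁱ : Carrier
      X  = p ^ suc j
      Xⁱ = X ^ i

      X^k : X ^ k ≈ X * (Xⁱ * X ^ c)
      X^k = trans (reflexive (≡.cong (X ^_) (≡.sym i+1+c≡k))) (*-congˡ (^-homo-* X i c))

      -- Passing from i to i + 1 multiplies the term by p^n X, and the factor 1 - p^n X of the
      -- difference extends `even-factor j n` to `even-factor (suc j) n`: the argument X becomes pX.
      -- The factor 1 + q p^n X split off `odd-factor` then yields the two terms of `J`.
      β-step : ∀ n → β j i n ≈ β j (suc i) n + Xⁱ * (α (suc j) i n + X * q * α (suc j) (suc i) n)
      β-step n = begin
        t * (K * A * Xⁱ) * E * O
          ≈⟨ *-congʳ (*-congˡ (even-factor-suc j n)) ⟩
        t * (K * A * Xⁱ) * (E′ + P * X * E) * O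
          ≈⟨ solve 9 (λ t K A Y E′ E P X O → t :* (K :* A :* Y) :* (E′ :+ P :* X :* E) :* O
                := t :* (K :* (P :* A) :* (X :* Y)) :* E :* O :+ t :* (K :* A :* Y) :* E′ :* O) refl t K A Xⁱ E′ E P X O ⟩
        β j (suc i) n + t * (K * A * Xⁱ) * E′ * O
          ≈⟨ +-congˡ (*-congˡ (odd-factor-suc j n)) ⟩
        β j (suc i) n + t * (K * A * Xⁱ) * E′ * ((1# + q * (P * X)) * O′)
          ≈⟨ +-congˡ (solve 9 (λ t K A Y E′ P X O′ q → t :* (K :* A :* Y) :* E′ :* ((con 1 :+ q :* (P :* X)) :* O′)
                := Y :* (t :* K :* A :* E′ :* O′ :+ X :* q :* (t :* K :* (P :* A) :* E′ :* O′))) refl t K A Xⁱ E′ P X O′ q) ⟩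
        β j (suc i) n + Xⁱ * (t * K * A * E′ * O′ + X * q * (t * K * (P * A) * E′ * O′))
          ≈⟨ +-congˡ (*-congˡ (+-cong (fold A) (*-congˡ (fold (P * A))))) ⟩
        β j (suc i) n + Xⁱ * (α (suc j) i n + X * q * α (suc j) (suc i) n) ∎
        where
        t P K A E E′ O O′ : Carrier
        t  = τ (suc j) n
        P  = p ^ n
        K  = P ^ k
        A  = P ^ i
        E  = even-factor j n
        E′ = even-factor (suc j) n
        O  = odd-factor j n
        O′ = odd-factor (suc j) n
        fold : ∀ y → t * K * y * E′ * O′ ≈ τ (suc (suc j)) n * y * E′ * O′
        fold y = *-congʳ (*-congʳ (*-congʳ (sym (τ-suc (suc j) n))))

      -- The difference in c gives 1 - p^(n+1), which extends `even-factor j (suc n)` at its lower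
      -- end, so the argument becomes pX while the index n + 1 drops to n. The X^k contained in τ
      -- splits as X · X^i · X^c, and X^c combines with p^c to the power (pX)^c of a `β` term.
      α-step : ∀ n → α j c (suc n) ≈ α j (suc c) (suc n) + s * Xⁱ * (β (suc j) (suc c) n + X * q * β (suc j) c n)
      α-step n = begin
        t′ * C′ * E * O
          ≈⟨ *-congʳ (*-congˡ (even-factor-shift j n)) ⟩
        t′ * C′ * (E′ + P′ * E) * O
          ≈⟨ solve 6 (λ t C E′ E P O → t :* C :* (E′ :+ P :* E) :* O := t :* (P :* C) :* E :* O :+ t :* C :* E′ :* O) refl t′ C′ E′ E P′ O ⟩
        α j (suc c) (suc n) + t′ * C′ * E′ * O
          ≈⟨ +-congˡ (*-cong (*-congʳ (*-cong (*-congʳ (*-congʳ (*-congʳ (*-congˡ X^k)))) (^-distrib-* p P c))) (odd-factor-shift j n)) ⟩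
        α j (suc c) (suc n) + s * q * (X * (Xⁱ * Xᶜ)) * K * K * t * (pᶜ * C) * E′ * ((1# + q * P) * O′)
          ≈⟨ +-congˡ (solve 12 (λ s q X Y Z K t pc C E O P →
               s :* q :* (X :* (Y :* Z)) :* K :* K :* t :* (pc :* C) :* E :* ((con 1 :+ q :* P) :* O)
               := s :* Y :* (t :* K :* (K :* (P :* C) :* (q :* q :* X :* (pc :* Z))) :* E :* O :+ X :* q :* (t :* K :* (K :* C :* (pc :* Z)) :* E :* O)))
               refl s q X Xⁱ Xᶜ K t pᶜ C E′ O′ P) ⟩
        α j (suc c) (suc n) + s * Xⁱ * (t * K * (K * (P * C) * (p * X * (pᶜ * Xᶜ))) * E′ * O′ + X * q * (t * K * (K * C * (pᶜ * Xᶜ)) * E′ * O′))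
          ≈⟨ +-congˡ (*-congˡ (+-cong (fold (*-congˡ (*-congˡ pX^c))) (*-congˡ (fold (*-congˡ pX^c))))) ⟩
        α j (suc c) (suc n) + s * Xⁱ * (β (suc j) (suc c) n + X * q * β (suc j) c n) ∎
        where
        t t′ P P′ K C C′ Xᶜ pᶜ E E′ O O′ : Carrier
        t  = τ (suc j) n
        t′ = τ (suc j) (suc n)
        P  = p ^ n
        P′ = p ^ suc n
        K  = P ^ k
        C  = P ^ c
        C′ = P′ ^ c
        Xᶜ = X ^ c
        pᶜ = p ^ c
        E  = even-factor j (suc n)
        E′ = even-factor (suc j) n
        O  = odd-factor j (suc n)
        O′ = odd-factor (suc j) n
        pX^c : pᶜ * Xᶜ ≈ (p * X) ^ c
        pX^c = sym (^-distrib-* p X c)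
        fold : ∀ {y y′} → y ≈ y′ → t * K * y * E′ * O′ ≈ τ (suc (suc j)) n * y′ * E′ * O′
        fold y≈y′ = *-congʳ (*-congʳ (*-cong (sym (τ-suc (suc j) n)) y≈y′))

      ∑α-step : ∑ N (α j c) ≈ ∑ N (α j (suc c)) + s * Xⁱ * (∑ N (β (suc j) (suc c)) + X * q * ∑ N (β (suc j) c))
      ∑α-step = begin
        ∑ N (α j c)
          ≈⟨ ∑-shift N (α j c) (α-zero c) ⟨
        α j c 0 + ∑ N (λ n → α j c (suc n))
          -- At n = 0 the power (p^n)^c is a power of 1, so c and c + 1 give the same term.
          ≈⟨ +-cong (*-congʳ (*-congʳ (*-congˡ (sym (*-identityˡ _))))) (trans (∑-cong N λ n _ → α-step n) (∑-+ N _ _)) ⟩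
        α j (suc c) 0 + (∑ N (λ n → α j (suc c) (suc n)) + ∑ N (λ n → s * Xⁱ * (β (suc j) (suc c) n + X * q * β (suc j) c n)))
          ≈⟨ +-assoc _ _ _ ⟨
        α j (suc c) 0 + ∑ N (λ n → α j (suc c) (suc n)) + ∑ N (λ n → s * Xⁱ * (β (suc j) (suc c) n + X * q * β (suc j) c n))
          ≈⟨ +-cong (∑-shift N (α j (suc c)) (α-zero (suc c)))
               (trans (sym (∑-*ˡ N _ _)) (*-congˡ (trans (∑-+ N _ _) (+-congˡ (sym (∑-*ˡ N _ _)))))) ⟩
        ∑ N (α j (suc c)) + s * Xⁱ * (∑ N (β (suc j) (suc c)) + X * q * ∑ N (β (suc j) c)) ∎
        where
        α-zero : ∀ c → α j c N ≈ 0#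
        α-zero c = trans (*-congʳ (trans (*-congʳ (trans (*-congʳ (τ-zero (suc j) N ℕₚ.≤-refl)) (zeroˡ _))) (zeroˡ _))) (zeroˡ _)

      ∑β-step : ∑ N (β j i) ≈ ∑ N (β j (suc i)) + Xⁱ * (∑ N (α (suc j) i) + X * q * ∑ N (α (suc j) (suc i)))
      ∑β-step = trans (∑-cong N λ n _ → β-step n) (trans (∑-+ N _ _) (+-congˡ
        (trans (sym (∑-*ˡ N _ _)) (*-congˡ (trans (∑-+ N _ _) (+-congˡ (sym (∑-*ˡ N _ _))))))))

      H-step : H j (suc i) c ≈ H j i (suc c) + Xⁱ * J (suc j) c i
      H-step = begin
        ∑ N (α j c) + s * b₁
          ≈⟨ +-cong ∑α-step (sym (move-s b₀ b₁ z ∑β-step)) ⟩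
        a₁ + s * Xⁱ * (b₂ + X * q * b₃) + (s * b₀ + Xⁱ * (a₂ + X * q * a₃))
          ≈⟨ solve 10 (λ a₁ s Y b₂ X q b₃ b₀ a₂ a₃ → a₁ :+ s :* Y :* (b₂ :+ X :* q :* b₃) :+ (s :* b₀ :+ Y :* (a₂ :+ X :* q :* a₃))
                := a₁ :+ s :* b₀ :+ Y :* (a₂ :+ s :* b₂ :+ X :* q :* (a₃ :+ s :* b₃))) refl a₁ s Xⁱ b₂ X q b₃ b₀ a₂ a₃ ⟩
        H j i (suc c) + Xⁱ * J (suc j) c i ∎
        where
        a₁ a₂ a₃ b₀ b₁ b₂ b₃ z : Carrier
        a₁ = ∑ N (α j (suc c))
        a₂ = ∑ N (α (suc j) i)
        a₃ = ∑ N (α (suc j) (suc i))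
        b₀ = ∑ N (β j i)
        b₁ = ∑ N (β j (suc i))
        b₂ = ∑ N (β (suc j) (suc c))
        b₃ = ∑ N (β (suc j) c)
        z  = Xⁱ * (a₂ + X * q * a₃)

    -- At i = 0 the factor 1 - x^i p^(2in) of every summand vanishes. This starts the induction on
    -- i: no partition has fewer than zero copies of a part.
    H-zero : ∀ j → H j 0 k ≈ 0#
    H-zero j = trans (+-congˡ (*-congˡ (∑-cong N λ n _ → *-congʳ (*-congʳ (*-congˡ (trans (*-identityʳ _) (*-identityʳ _)))))))
      (x+sx≈0 (∑ N (α j k)))

    1^ : ∀ m → 1# ^ m ≈ 1#
    1^ zero    = refl
    1^ (suc m) = trans (*-identityˡ _) (1^ m)

    -- Here p^j = 0, so whatever contains a positive power of x disappears: all of `β` because i >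
    -- 0, the second `H`, and the terms n > 0 of `α` because k > 0. Only the term n = 0 of `α` is
    -- left.
    J-limit : ∀ {k′} → k ≡ suc k′ → ∀ j i′ c → N ℕ.≤ j → J j i′ c ≈ even-tail 0
    J-limit {k′} ≡.refl j i′ c N≤j = begin
      ∑ N (α j c) + s * ∑ N (β j (suc i′)) + p ^ j * q * H j i′ (suc c)
        ≈⟨ +-cong (+-cong (sym (∑-shift N (α j c) (0*x _ _ (τ-zero (suc j) N ℕₚ.≤-refl)))) (*-congˡ (∑-0 N λ n _ → β-vanishes n)))
             (trans (*-congʳ (trans (*-congʳ (p^≥N≈0 j N≤j)) (zeroˡ q))) (zeroˡ _)) ⟩
      α j c 0 + ∑ N (λ n → α j c (suc n)) + s * 0# + 0#
        ≈⟨ trans (+-identityʳ _) (+-cong (+-congˡ (∑-0 N λ n _ → 0*x _ _ (τ-vanishes n))) (zeroʳ s)) ⟩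
      α j c 0 + 0# + 0#
        ≈⟨ trans (+-identityʳ _) (+-identityʳ _) ⟩
      1# * 1# ^ c * even-factor j 0 * (1# * odd-tail (suc j))
        ≈⟨ *-cong (*-cong (trans (*-identityˡ _) (1^ c)) (even-∏≈tail j N≤j)) (trans (*-identityˡ _) (odd-tail-1 (suc j) (ℕₚ.m≤n⇒m≤1+n N≤j))) ⟩
      1# * even-tail 0 * 1#
        ≈⟨ trans (*-identityʳ _) (*-identityˡ _) ⟩
      even-tail 0 ∎
      where
      0*x : ∀ {t} a b {e} → t ≈ 0# → t * a * b * e ≈ 0#
      0*x a b t≈0 = trans (*-congʳ (trans (*-congʳ (trans (*-congʳ t≈0) (zeroˡ a))) (zeroˡ b))) (zeroˡ _)
      X≈0 : p ^ suc j ≈ 0#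
      X≈0 = p^≥N≈0 (suc j) (ℕₚ.m≤n⇒m≤1+n N≤j)
      X^≈0 : ∀ m → (p ^ suc j) ^ suc m ≈ 0#
      X^≈0 m = trans (*-congʳ X≈0) (zeroˡ _)
      β-vanishes : ∀ n → β j (suc i′) n ≈ 0#
      β-vanishes n = trans (*-congʳ (*-congʳ (trans (*-congˡ (trans (*-congˡ (X^≈0 i′)) (zeroʳ _))) (zeroʳ _)))) (trans (*-congʳ (zeroˡ _)) (zeroˡ _))
      τ-vanishes : ∀ n → τ (suc j) (suc n) ≈ 0#
      τ-vanishes n = trans (*-congʳ (trans (*-congʳ (trans (*-congʳ (trans (*-congˡ (X^≈0 k′)) (zeroʳ _))) (zeroˡ _))) (zeroˡ _))) (zeroˡ _)

    s*s≈1 : s * s ≈ 1#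
    s*s≈1 = +-cancelʳ s (trans (+-comm _ _) (trans (x+sx≈0 s) (sym 1+s≈0)))

    module _ (i′ c : ℕ) (i′+1+c≡k : suc (i′ ℕ.+ c) ≡ k) where

      -- Read off from the theta series at x = 1. Its term of index n ≥ 0 is (-1)^n q^n p^(kn²+cn),
      -- which equals z^n (zw)^(n(n-1)/2) for z = -q p^(k+c) and zw = p^(2k). The terms coming from
      -- `β` have the indices -(n+1) and determine w.
      z w : Carrier
      z = q * (s * (p ^ k * p ^ c))
      w = q * (s * p ^ i′)

      z*w≈p^k*p^k : z * w ≈ p ^ k * p ^ k
      z*w≈p^k*p^k = begin
        z * w                                     ≈⟨ solve 5 (λ q s K c i → q :* (s :* (K :* c)) :* (q :* (s :* i)) := s :* s :* (K :* (q :* q :* (i :* c)))) refl q s (p ^ k) (p ^ c) (p ^ i′) ⟩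
        s * s * (p ^ k * (p * (p ^ i′ * p ^ c)))  ≈⟨ *-cong s*s≈1 (*-congˡ (*-congˡ (sym (^-homo-* p i′ c)))) ⟩
        1# * (p ^ k * p ^ suc (i′ ℕ.+ c))         ≈⟨ *-identityˡ _ ⟩
        p ^ k * p ^ suc (i′ ℕ.+ c)                ≈⟨ *-congˡ (reflexive (≡.cong (p ^_) i′+1+c≡k)) ⟩
        p ^ k * p ^ k                             ∎

      [z*w]^n : ∀ n → (z * w) ^ n ≈ (p ^ n) ^ k * (p ^ n) ^ k
      [z*w]^n n = trans (^-congˡ n z*w≈p^k*p^k) (trans (^-distrib-* (p ^ k) (p ^ k) n) (*-cong swap swap))
        where
        swap : (p ^ k) ^ n ≈ (p ^ n) ^ k
        swap = trans (^-assocʳ p k n) (trans (reflexive (≡.cong (p ^_) (ℕₚ.*-comm k n))) (sym (^-assocʳ p n k)))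

      z^N≈0 : z ^ N ≈ 0#
      z^N≈0 = *-^-zero {q} {N} _ q^N≈0

      w^N≈0 : w ^ N ≈ 0#
      w^N≈0 = *-^-zero {q} {N} _ q^N≈0

      tri : Carrier → ℕ → Carrier
      tri = triangular z w N z^N≈0 w^N≈0

      αˢ βˢ : ℕ → Carrier
      αˢ n = τ 1 n * (p ^ n) ^ c
      βˢ n = τ 1 n * ((p ^ n) ^ k * (p ^ n) ^ i′ * p ^ i′) * q

      p^1^ : ∀ m → (p ^ 1) ^ m ≈ p ^ m
      p^1^ m = ^-congˡ m (*-identityʳ p)

      αˢ≈tri : ∀ n → αˢ n ≈ tri z n
      αˢ≈tri zero    = trans (*-identityˡ _) (1^ c)
      αˢ≈tri (suc n) = begin
        s * q * (p ^ 1) ^ k * K * K * τ 1 n * (p * p ^ n) ^ c      ≈⟨ *-cong (*-congʳ (*-congʳ (*-congʳ (*-congˡ (p^1^ k))))) (^-distrib-* p (p ^ n) c) ⟩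
        s * q * p ^ k * K * K * τ 1 n * (p ^ c * (p ^ n) ^ c)      ≈⟨ solve 7 (λ s q pk K t pc C → s :* q :* pk :* K :* K :* t :* (pc :* C)
                                                                          := q :* (s :* (pk :* pc)) :* (K :* K) :* (t :* C)) refl s q (p ^ k) K (τ 1 n) (p ^ c) ((p ^ n) ^ c) ⟩
        z * (K * K) * αˢ n                                         ≈⟨ *-cong (*-congˡ (sym ([z*w]^n n))) (αˢ≈tri n) ⟩
        z * (z * w) ^ n * tri z n                                  ∎
        where
        K : Carrier
        K = (p ^ n) ^ k

      sβˢ≈tri : ∀ n → s * βˢ n ≈ tri w (suc n)
      sβˢ≈tri zero    = begin
        s * (1# * (1# ^ k * 1# ^ i′ * p ^ i′) * q)   ≈⟨ *-congˡ (*-congʳ (*-congˡ (*-congʳ (*-cong (1^ k) (1^ i′))))) ⟩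
        s * (1# * (1# * 1# * p ^ i′) * q)            ≈⟨ solve 3 (λ s q i → s :* (con 1 :* (con 1 :* con 1 :* i) :* q) := q :* (s :* i) :* con 1 :* con 1) refl s q (p ^ i′) ⟩
        w * 1# * 1#                                  ∎
      sβˢ≈tri (suc n) = begin
        s * (s * q * (p ^ 1) ^ k * K * K * τ 1 n * ((p * p ^ n) ^ k * (p * p ^ n) ^ i′ * p ^ i′) * q)
          ≈⟨ *-congˡ (*-congʳ (*-cong (*-congʳ (*-congʳ (*-congʳ (*-congˡ (p^1^ k))))) (*-congʳ (*-cong (^-distrib-* p (p ^ n) k) (^-distrib-* p (p ^ n) i′))))) ⟩
        s * (s * q * p ^ k * K * K * τ 1 n * (p ^ k * K * (p ^ i′ * I) * p ^ i′) * q)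
          ≈⟨ solve 7 (λ s q pk K t pi I → s :* (s :* q :* pk :* K :* K :* t :* (pk :* K :* (pi :* I) :* pi) :* q)
                := q :* (s :* pi) :* (pk :* pk :* (K :* K)) :* (s :* (t :* (K :* I :* pi) :* q))) refl s q (p ^ k) K (τ 1 n) (p ^ i′) I ⟩
        w * (p ^ k * p ^ k * (K * K)) * (s * βˢ n)
          ≈⟨ *-cong (*-congˡ (*-cong (sym z*w≈p^k*p^k) (sym ([z*w]^n n)))) (sβˢ≈tri n) ⟩
        w * (z * w) ^ suc n * tri w (suc n) ∎
        where
        K I : Carrier
        K = (p ^ n) ^ k
        I = (p ^ n) ^ i′

      -- `odd-factor 0 n` is the product of all 1 + q p^m except the one with m = n.
      odd-merge : ∀ n → (1# + q * p ^ n) * odd-factor 0 n ≈ odd-tail 0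
      odd-merge n = begin
        (1# + q * p ^ n) * (odd-init n * odd-tail (n ℕ.+ 1))   ≈⟨ solve 3 (λ a b c → a :* (b :* c) := b :* a :* c) refl (1# + q * p ^ n) (odd-init n) (odd-tail (n ℕ.+ 1)) ⟩
        odd-init n * (1# + q * p ^ n) * odd-tail (n ℕ.+ 1)     ≈⟨ *-cong (sym (∏-last n (λ m → 1# + q * p ^ m))) (reflexive (≡.cong odd-tail (ℕₚ.+-comm n 1))) ⟩
        odd-init (suc n) * odd-tail (suc n)                    ≈⟨ odd-∏*tail (suc n) ⟩
        odd-tail 0                                             ∎

      α-collapse : ∀ n → α 0 c n + 1# * q * α 0 (suc c) n ≈ odd-tail 0 * αˢ n
      α-collapse n = begin
        α 0 c n + 1# * q * α 0 (suc c) n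
          ≈⟨ solve 5 (λ t C P q O → t :* C :* con 1 :* O :+ con 1 :* q :* (t :* (P :* C) :* con 1 :* O) := (con 1 :+ q :* P) :* O :* (t :* C))
               refl (τ 1 n) ((p ^ n) ^ c) (p ^ n) q (odd-factor 0 n) ⟩
        (1# + q * p ^ n) * odd-factor 0 n * αˢ n
          ≈⟨ *-congʳ (odd-merge n) ⟩
        odd-tail 0 * αˢ n ∎

      -- The two terms are in the ratio p^(n+1) : q, and p^(n+1) + q = q (1 + q p^n) because p = q².
      -- Hence the extra q in `βˢ`.
      β-collapse : ∀ n → β 0 (suc i′) n + 1# * q * β 0 i′ n ≈ odd-tail 0 * βˢ n
      β-collapse n = begin
        β 0 (suc i′) n + 1# * q * β 0 i′ n
          ≈⟨ +-cong (*-congʳ (*-congʳ (*-congˡ (*-congˡ (*-cong (*-identityʳ p) (p^1^ i′)))))) (*-congˡ (*-congʳ (*-congʳ (*-congˡ (*-congˡ (p^1^ i′)))))) ⟩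
        τ 1 n * (K * (p ^ n * I) * (p * p ^ i′)) * 1# * O + 1# * q * (τ 1 n * (K * I * p ^ i′) * 1# * O)
          ≈⟨ solve 7 (λ t K P I q pi O → t :* (K :* (P :* I) :* (q :* q :* pi)) :* con 1 :* O :+ con 1 :* q :* (t :* (K :* I :* pi) :* con 1 :* O)
                := (con 1 :+ q :* P) :* O :* (t :* (K :* I :* pi) :* q)) refl (τ 1 n) K (p ^ n) I q (p ^ i′) O ⟩
        (1# + q * p ^ n) * O * βˢ n
          ≈⟨ *-congʳ (odd-merge n) ⟩
        odd-tail 0 * βˢ n ∎
        where
        K I O : Carrier
        K = (p ^ n) ^ k
        I = (p ^ n) ^ i′
        O = odd-factor 0 n

      J-theta : J 0 i′ c ≈ odd-tail 0 * theta z w N z^N≈0 w^N≈0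
      J-theta = begin
        ∑ N (α 0 c) + s * ∑ N (β 0 (suc i′)) + 1# * q * (∑ N (α 0 (suc c)) + s * ∑ N (β 0 i′))
          ≈⟨ solve 6 (λ a b d e s q → a :+ s :* b :+ con 1 :* q :* (d :+ s :* e) := a :+ con 1 :* q :* d :+ s :* (b :+ con 1 :* q :* e)) refl
               (∑ N (α 0 c)) (∑ N (β 0 (suc i′))) (∑ N (α 0 (suc c))) (∑ N (β 0 i′)) s q ⟩
        ∑ N (α 0 c) + 1# * q * ∑ N (α 0 (suc c)) + s * (∑ N (β 0 (suc i′)) + 1# * q * ∑ N (β 0 i′))
          ≈⟨ +-cong (combine α-collapse) (*-congˡ (combine β-collapse)) ⟩
        odd-tail 0 * ∑ N αˢ + s * (odd-tail 0 * ∑ N βˢ)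
          ≈⟨ solve 4 (λ o a s b → o :* a :+ s :* (o :* b) := o :* (a :+ s :* b)) refl (odd-tail 0) (∑ N αˢ) s (∑ N βˢ) ⟩
        odd-tail 0 * (∑ N αˢ + s * ∑ N βˢ)
          ≈⟨ *-congˡ (+-cong (∑-cong N λ n _ → αˢ≈tri n) (trans (∑-*ˡ N s βˢ) (∑-cong N λ n _ → sβˢ≈tri n))) ⟩
        odd-tail 0 * theta z w N z^N≈0 w^N≈0 ∎
        where
        combine : ∀ {f g h : ℕ → Carrier} {o r} → (∀ n → f n + r * g n ≈ o * h n) → ∑ N f + r * ∑ N g ≈ o * ∑ N h
        combine e = trans (+-congˡ (∑-*ˡ N _ _)) (trans (sym (∑-+ N _ _)) (trans (∑-cong N λ n _ → e n) (sym (∑-*ˡ N _ _))))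

-- Enumerating partitions by the multiplicity of the smallest part

module Enumerations where

  open import Data.Bool using (true; false; if_then_else_)
  open import Data.List using (List; []; _∷_; _++_; map; replicate)
  open import Data.List.Properties using (++-cancelʳ)
  open import Data.List.Membership.Propositional using (_∈_)
  open import Data.List.Membership.Propositional.Properties using (∈-++⁺ˡ; ∈-++⁺ʳ; ∈-++⁻; ∈-map⁺; ∈-map⁻)
  open import Data.List.Relation.Unary.All as All using (All; []; _∷_)
  import Data.List.Relation.Unary.All.Properties as Allₚ
  open import Data.List.Relation.Unary.AllPairs as AllPairs using (AllPairs; []; _∷_)
  import Data.List.Relation.Unary.AllPairs.Properties as AllPairsₚ
  open import Data.List.Relation.Unary.Any using (here)
  open import Data.List.Relation.Unary.Unique.Propositional using (Unique)
  import Data.List.Relation.Unary.Unique.Propositional.Properties as Uniqueₚ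
  open import Data.Nat using (ℕ; s≤s⁻¹; zero; suc; _+_; _*_; _∸_; _≤_; _<_; _≥_; z≤n; s≤s; _≡ᵇ_; _≟_)
  open import Data.Nat.Properties hiding (_≟_)
  open import Data.Product using (_×_; _,_; proj₁; proj₂; ∃-syntax)
  open import Data.Sum using (inj₁; inj₂)
  open import Function using (_∘_; _⇔_; mk⇔; Equivalence)
  open import Relation.Binary.PropositionalEquality using (_≡_; _≢_; refl; sym; trans; cong; cong₂; subst)
  open import Relation.Nullary using (¬_; yes; no; contradiction)

  mult : ℕ → List ℕ → ℕ
  mult y []       = 0
  mult y (x ∷ xs) = (if x ≡ᵇ y then 1 else 0) + mult y xs

  mult-here : ∀ y xs → mult y (y ∷ xs) ≡ suc (mult y xs)
  mult-here y xs with y ≡ᵇ y | ≡⇒≡ᵇ y y refl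
  ... | true | _ = refl

  mult-there : ∀ {x y} xs → x ≢ y → mult y (x ∷ xs) ≡ mult y xs
  mult-there {x} {y} xs x≢y with x ≡ᵇ y | ≡ᵇ⇒≡ x y
  ... | false | _   = refl
  ... | true  | x≡y = contradiction (x≡y _) x≢y

  mult-++ : ∀ y xs ys → mult y (xs ++ ys) ≡ mult y xs + mult y ys
  mult-++ y []       ys = refl
  mult-++ y (x ∷ xs) ys = trans (cong (_ +_) (mult-++ y xs ys)) (sym (+-assoc _ (mult y xs) (mult y ys)))

  mult-replicate : ∀ y e → mult y (replicate e y) ≡ e
  mult-replicate y zero    = refl
  mult-replicate y (suc e) = trans (mult-here y (replicate e y)) (cong suc (mult-replicate y e))

  mult-absent : ∀ y xs → All (_≢ y) xs → mult y xs ≡ 0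
  mult-absent y []       []           = refl
  mult-absent y (x ∷ xs) (x≢y ∷ xs≢y) = trans (mult-there xs x≢y) (mult-absent y xs xs≢y)

  mult-below : ∀ {y l xs} → All (l ≤_) xs → y < l → mult y xs ≡ 0
  mult-below {y} {l} {xs} l≤xs y<l = mult-absent y xs (All.map (λ l≤x x≡y → <-irrefl (sym x≡y) (<-≤-trans y<l l≤x)) l≤xs)

  mult-snoc : ∀ y l e xs → y ≢ l → mult y (xs ++ replicate e l) ≡ mult y xs
  mult-snoc y l e xs y≢l = trans (mult-++ y xs (replicate e l))
    (trans (cong (mult y xs +_) (mult-absent y (replicate e l) (Allₚ.replicate⁺ e (y≢l ∘ sym)))) (+-identityʳ _))

  mult-snoc-here : ∀ l e xs → All (suc l ≤_) xs → mult l (xs ++ replicate e l) ≡ e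
  mult-snoc-here l e xs l<xs = trans (mult-++ l xs (replicate e l)) (cong₂ _+_ (mult-below l<xs ≤-refl) (mult-replicate l e))

  mult≤mult-++ : ∀ y xs ys → mult y xs ≤ mult y (xs ++ ys)
  mult≤mult-++ y xs ys = subst (mult y xs ≤_) (sym (mult-++ y xs ys)) (m≤m+n _ _)

  Shape : ℕ → ℕ → List ℕ → Set
  Shape lo hi b = AllPairs _≥_ b × All (lo ≤_) b × All (_≤ hi) b

  Enumerates : (List ℕ → Set) → List (List ℕ) → Set
  Enumerates P xs = Unique xs × (∀ {b} → b ∈ xs → P b) × (∀ {b} → P b → b ∈ xs)

  module _ {lo hi e : ℕ} {b : List ℕ} where
    shape-snoc : lo ≤ hi → Shape (suc lo) hi b → Shape lo hi (b ++ replicate e lo)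
    shape-snoc lo≤hi (b↘ , lo<b , b≤hi) =
      AllPairsₚ.++⁺ b↘ (replicate-↘ e) (All.map (λ lo<x → Allₚ.replicate⁺ e (<⇒≤ lo<x)) lo<b) ,
      Allₚ.++⁺ (All.map <⇒≤ lo<b) (Allₚ.replicate⁺ e ≤-refl) ,
      Allₚ.++⁺ b≤hi (Allₚ.replicate⁺ e lo≤hi)
      where
      replicate-↘ : ∀ e → AllPairs _≥_ (replicate e lo)
      replicate-↘ zero    = []
      replicate-↘ (suc e) = Allₚ.replicate⁺ e ≤-refl ∷ replicate-↘ e

  shape-split : ∀ {lo hi} b → Shape lo hi b → ∃[ b′ ] ∃[ e ] (b ≡ b′ ++ replicate e lo × Shape (suc lo) hi b′)
  shape-split [] _ = [] , 0 , refl , [] , [] , []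
  shape-split {lo} (x ∷ xs) (x≥xs ∷ xs↘ , lo≤x ∷ lo≤xs , x≤hi ∷ xs≤hi)
    with shape-split xs (xs↘ , lo≤xs , xs≤hi) | x ≟ lo
  ... | b′ , e , refl , b′↘ , lo<b′ , b′≤hi | no x≢lo =
    x ∷ b′ , e , refl , Allₚ.++⁻ˡ b′ x≥xs ∷ b′↘ , ≤∧≢⇒< lo≤x (x≢lo ∘ sym) ∷ lo<b′ , x≤hi ∷ b′≤hi
  ... | [] , e , refl , _ | yes refl = [] , suc e , refl , [] , [] , []
  ... | y ∷ _ , e , refl , _ , lo<y ∷ _ , _ | yes refl = contradiction (All.head x≥xs) (<⇒≱ lo<y)

  module _ (l : ℕ) where

    peel : ℕ → (ℕ → List (List ℕ)) → List (List ℕ)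
    peel zero    E = []
    peel (suc K) E = peel K E ++ map (_++ replicate K l) (E K)

    ∈-peel⁺ : ∀ K E {b e} → e < K → b ∈ E e → b ++ replicate e l ∈ peel K E
    ∈-peel⁺ (suc K) E {b} {e} (s≤s e≤K) b∈ with e ≟ K
    ... | yes refl = ∈-++⁺ʳ (peel K E) (∈-map⁺ (_++ replicate K l) b∈)
    ... | no  e≢K  = ∈-++⁺ˡ (∈-peel⁺ K E (≤∧≢⇒< e≤K e≢K) b∈)

    ∈-peel⁻ : ∀ K E {b} → b ∈ peel K E → ∃[ b′ ] ∃[ e ] (e < K × b′ ∈ E e × b ≡ b′ ++ replicate e l)
    ∈-peel⁻ (suc K) E b∈ with ∈-++⁻ (peel K E) b∈
    ... | inj₁ b∈ˡ = let b′ , e , e<K , b′∈ , b≡ = ∈-peel⁻ K E b∈ˡ in b′ , e , m≤n⇒m≤1+n e<K , b′∈ , b≡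
    ... | inj₂ b∈ʳ = let b′ , b′∈ , b≡ = ∈-map⁻ _ b∈ʳ in b′ , K , ≤-refl , b′∈ , b≡

    -- The multiplicity of l reveals from which `E e` a list was built, since the lists in `E e`
    -- have only parts above l.
    peel-unique : ∀ K E → (∀ e → e < K → Unique (E e)) → (∀ e {b} → e < K → b ∈ E e → All (suc l ≤_) b) → Unique (peel K E)
    peel-unique zero    E E! l<E = []
    peel-unique (suc K) E E! l<E = Uniqueₚ.++⁺
      (peel-unique K E (λ e e<K → E! e (m≤n⇒m≤1+n e<K)) (λ e e<K → l<E e (m≤n⇒m≤1+n e<K)))
      (Uniqueₚ.map⁺ (λ {x} {y} → ++-cancelʳ (replicate K l) x y) (E! K ≤-refl))
      disjoint
      where
      disjoint : ∀ {b} → ¬ (b ∈ peel K E × b ∈ map (_++ replicate K l) (E K))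
      disjoint (b∈ˡ , b∈ʳ) with ∈-peel⁻ K E b∈ˡ | ∈-map⁻ _ b∈ʳ
      ... | b₁ , e , e<K , b₁∈ , refl | b₂ , b₂∈ , b₁≡b₂ = <⇒≢ e<K
        (trans (sym (mult-snoc-here l e b₁ (l<E e (m≤n⇒m≤1+n e<K) b₁∈))) (trans (cong (mult l) b₁≡b₂) (mult-snoc-here l K b₂ (l<E K ≤-refl b₂∈))))

    peel-enumerates : ∀ {hi} (P : ℕ → List ℕ → Set) (Q : List ℕ → Set) K E → l ≤ hi →
      (∀ e → e < K → Enumerates (λ b → Shape (suc l) hi b × P e b) (E e)) →
      (∀ e b → Shape (suc l) hi b → (e < K × P e b) ⇔ Q (b ++ replicate e l)) →
      Enumerates (λ b → Shape l hi b × Q b) (peel K E)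
    peel-enumerates {hi} P Q K E l≤hi E-enum P⇔Q = unique , sound , complete
      where
      unique : Unique (peel K E)
      unique = peel-unique K E (λ e e<K → proj₁ (E-enum e e<K))
        (λ e e<K b∈ → proj₁ (proj₂ (proj₁ (proj₁ (proj₂ (E-enum e e<K)) b∈))))
      sound : ∀ {b} → b ∈ peel K E → Shape l hi b × Q b
      sound b∈ with ∈-peel⁻ K E b∈
      ... | b′ , e , e<K , b′∈ , refl = let shape , Pb′ = proj₁ (proj₂ (E-enum e e<K)) b′∈ in
        shape-snoc l≤hi shape , Equivalence.to (P⇔Q e b′ shape) (e<K , Pb′)
      complete : ∀ {b} → Shape l hi b × Q b → b ∈ peel K E
      complete {b} (shape , Qb) with shape-split b shape
      ... | b′ , e , refl , shape′ = let e<K , Pb′ = Equivalence.from (P⇔Q e b′ shape′) Qb in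
        ∈-peel⁺ K E e<K (proj₂ (proj₂ (E-enum e e<K)) (shape′ , Pb′))

  enumerates-[] : ∀ {lo hi} (P : List ℕ → Set) → hi < lo → P [] → Enumerates (λ b → Shape lo hi b × P b) ([] ∷ [])
  enumerates-[] {lo} {hi} P hi<lo P[] = ([] ∷ []) , (λ { (here refl) → ([] , [] , []) , P[] }) , complete
    where
    complete : ∀ {b} → Shape lo hi b × P b → b ∈ ([] ∷ [])
    complete {[]}    _ = here refl
    complete {x ∷ b} ((_ , lo≤x ∷ _ , x≤hi ∷ _) , _) = contradiction (≤-trans lo≤x x≤hi) (<⇒≱ hi<lo)

  module BoundedMultiplicities (cap : ℕ → ℕ) (0<cap : ∀ y → 0 < cap y) where

    Capped : List ℕ → Set
    Capped b = ∀ y → mult y b < cap y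

    enumCapped : ℕ → ℕ → List (List ℕ)
    enumCapped zero    m = [] ∷ []
    enumCapped (suc t) m = peel (suc m) (cap (suc m)) (λ _ → enumCapped t (suc m))

    enumCapped-enumerates : ∀ t m M → m + t ≡ M → Enumerates (λ b → Shape (suc m) M b × Capped b) (enumCapped t m)
    enumCapped-enumerates zero m M m≡M = enumerates-[] Capped (s≤s (≤-reflexive (trans (sym m≡M) (+-identityʳ m)))) 0<cap
    enumCapped-enumerates (suc t) m M m+t≡M = peel-enumerates (suc m) (λ _ → Capped) Capped (cap (suc m)) _
      (subst (suc m ≤_) m+1+t≡M (m≤m+n (suc m) t))
      (λ _ _ → enumCapped-enumerates t (suc m) M m+1+t≡M)
      (λ e b shape → mk⇔ (λ (e<cap , capped) y → to e b shape e<cap capped y)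
        (λ capped → subst (_< cap (suc m)) (mult-snoc-here (suc m) e b (proj₁ (proj₂ shape))) (capped (suc m)) ,
          λ y → ≤-<-trans (mult≤mult-++ y b (replicate e (suc m))) (capped y)))
      where
      m+1+t≡M : suc m + t ≡ M
      m+1+t≡M = trans (sym (+-suc m t)) m+t≡M
      to : ∀ e b → Shape (suc (suc m)) M b → e < cap (suc m) → Capped b → Capped (b ++ replicate e (suc m))
      to e b shape e<cap capped y with y ≟ suc m
      ... | yes refl = subst (_< cap (suc m)) (sym (mult-snoc-here (suc m) e b (proj₁ (proj₂ shape)))) e<cap
      ... | no  y≢m  = subst (_< cap y) (sym (mult-snoc y (suc m) e b y≢m)) (capped y)

  <∸⇒+≤ : ∀ e {x i} → e < 2 → x < suc i ∸ e → e + x ≤ i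
  <∸⇒+≤ 0             _              x< = s≤s⁻¹ x<
  <∸⇒+≤ 1             _              x< = x<
  <∸⇒+≤ (suc (suc _)) (s≤s (s≤s ())) x<

  odd≢even : ∀ m j → suc (m * 2) ≢ j * 2
  odd≢even zero    (suc j) ()
  odd≢even (suc m) (suc j) eq = odd≢even m j (suc-injective (suc-injective eq))

  module SparsePartitions (k : ℕ) where

    -- b_p - b_{p+k-1} is at least 2 (b_p odd) or more than 2 (b_p even) exactly when the parts b_p ≥ … ≥ b_{p+k-1} do not
    -- all lie in one window {2m, 2m+1, 2m+2}; so the gap condition bounds the number of parts in every window.
    window : ℕ → List ℕ → ℕ
    window m b = mult (m * 2) b + (mult (1 + m * 2) b + mult (2 + m * 2) b)

    Sparse : List ℕ → Set
    Sparse b = (∀ m → mult (1 + m * 2) b ≤ 1) × (∀ m → window m b < k)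

    -- All parts are at most 2(j+t). In `enumD` they exceed 2j and at most i equal 2j+1 or 2j+2 (so
    -- i is one less than the index of D); in `enumG` they are at least 2j and fewer than i equal
    -- 2j. With e copies of 2j the window {2j, 2j+1, 2j+2} admits k - 1 - e further parts, whence
    -- `k ∸ suc e`. The bound 2 in `enumD` keeps 2j+1 from being repeated.
    enumD enumG : ℕ → ℕ → ℕ → List (List ℕ)
    enumD zero    j i = [] ∷ []
    enumD (suc t) j i = peel (1 + j * 2) 2 (λ e → enumG t (suc j) (suc i ∸ e))
    enumG t       j i = peel (j * 2) i (λ e → enumD t j (k ∸ suc e))

    window-++ : ∀ m b b′ → window m b ≤ window m (b ++ b′)
    window-++ m b b′ = +-mono-≤ (mult≤mult-++ (m * 2) b b′) (+-mono-≤ (mult≤mult-++ (1 + m * 2) b b′) (mult≤mult-++ (2 + m * 2) b b′))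

    sparse-++ : ∀ b b′ → Sparse (b ++ b′) → Sparse b
    sparse-++ b b′ (distinct , windows) =
      (λ m → ≤-trans (mult≤mult-++ (1 + m * 2) b b′) (distinct m)) ,
      (λ m → ≤-<-trans (window-++ m b b′) (windows m))

    SparseD SparseG : ℕ → ℕ → List ℕ → Set
    SparseD j i b = Sparse b × mult (1 + j * 2) b + mult (2 + j * 2) b ≤ i
    SparseG j i b = Sparse b × mult (j * 2) b < i

    module _ (j e : ℕ) (b : List ℕ) (j<b : All (1 + j * 2 ≤_) b) where

      private
        b⁺ : List ℕ
        b⁺ = b ++ replicate e (j * 2)

        here-≡ : mult (j * 2) b⁺ ≡ e
        here-≡ = mult-snoc-here (j * 2) e b j<b

        there-≡ : ∀ y → y ≢ j * 2 → mult y b⁺ ≡ mult y b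
        there-≡ y = mult-snoc y (j * 2) e b

        below-≡ : ∀ y → y < j * 2 → mult y b⁺ ≡ 0
        below-≡ y y<j = trans (there-≡ y (<⇒≢ y<j)) (mult-below j<b (m≤n⇒m≤1+n y<j))

        window-≡ : window j b⁺ ≡ e + (mult (1 + j * 2) b + mult (2 + j * 2) b)
        window-≡ = cong₂ _+_ here-≡ (cong₂ _+_ (there-≡ (1 + j * 2) (odd≢even j j)) (there-≡ (2 + j * 2) (m+1+n≢n 1)))

      -- The part 2j lies in two windows. Window j gives the bound in `SparseD`; window j - 1 (if j
      -- > 0) contains only the e copies, since all other parts exceed 2j, so e < k settles it.
      sparse-even : e < k → SparseD j (k ∸ suc e) b ⇔ Sparse b⁺
      sparse-even e<k = mk⇔
        (λ ((distinct , windows) , few) →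
          (λ m → subst (_≤ 1) (sym (there-≡ (1 + m * 2) (odd≢even m j))) (distinct m)) , window< windows few)
        (λ sparse → sparse-++ b _ sparse ,
          m+n≤o⇒m≤o∸n _ (subst (_≤ k) (+-comm (suc e) _) (subst (_< k) window-≡ (proj₂ sparse j))))
        where
        window< : (∀ m → window m b < k) → mult (1 + j * 2) b + mult (2 + j * 2) b ≤ k ∸ suc e → ∀ m → window m b⁺ < k
        window< windows few m with m ≟ j | suc m ≟ j
        ... | yes refl | _ = subst (_< k) (sym window-≡) (≤-trans (+-monoʳ-≤ (suc e) few) (≤-reflexive (m+[n∸m]≡n e<k)))
        ... | no _ | yes refl = subst (_< k)
          (sym (cong₂ _+_ (below-≡ (m * 2) (m≤n⇒m≤1+n ≤-refl)) (cong₂ _+_ (below-≡ (1 + m * 2) ≤-refl) here-≡))) e<k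
        ... | no m≢j | no 1+m≢j = subst (_< k)
          (sym (cong₂ _+_ (there-≡ (m * 2) (m≢j ∘ *-cancelʳ-≡ m j 2))
            (cong₂ _+_ (there-≡ (1 + m * 2) (odd≢even m j)) (there-≡ (2 + m * 2) (1+m≢j ∘ *-cancelʳ-≡ (suc m) j 2))))) (windows m)

    module _ (j e : ℕ) (b : List ℕ) (j<b : All (2 + j * 2 ≤_) b) where

      private
        b⁺ : List ℕ
        b⁺ = b ++ replicate e (1 + j * 2)

        here-≡ : mult (1 + j * 2) b⁺ ≡ e
        here-≡ = mult-snoc-here (1 + j * 2) e b j<b

        there-≡ : ∀ y → y ≢ 1 + j * 2 → mult y b⁺ ≡ mult y b
        there-≡ y = mult-snoc y (1 + j * 2) e b

        last-two : mult (1 + j * 2) b⁺ + mult (2 + j * 2) b⁺ ≡ e + mult (2 + j * 2) b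
        last-two = cong₂ _+_ here-≡ (there-≡ (2 + j * 2) (m+1+n≢n 0))

      -- The part 2j+1 lies in window j only. As b has no part 2j, this window holds just the parts
      -- 2j+1 and 2j+2, at most i of them, and i < k makes its condition automatic.
      sparse-odd : ∀ {i} → i < k → (e < 2 × SparseG (suc j) (suc i ∸ e) b) ⇔ SparseD j i b⁺
      sparse-odd {i} i<k = mk⇔
        (λ (e<2 , (distinct , windows) , few) →
          (distinct⁺ (s≤s⁻¹ e<2) distinct , window< windows (few⁺ e<2 few)) , subst (_≤ i) (sym last-two) (few⁺ e<2 few))
        (λ (sparse , few) → s≤s (subst (_≤ 1) here-≡ (proj₁ sparse j)) , sparse-++ b _ sparse , few⁻ (subst (_≤ i) last-two few))
        where
        few⁺ : e < 2 → mult (2 + j * 2) b < suc i ∸ e → e + mult (2 + j * 2) b ≤ i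
        few⁺ e<2 few = <∸⇒+≤ e e<2 few
        few⁻ : e + mult (2 + j * 2) b ≤ i → mult (2 + j * 2) b < suc i ∸ e
        few⁻ few = m+n≤o⇒m≤o∸n _ (s≤s (subst (_≤ i) (+-comm e _) few))
        distinct⁺ : e ≤ 1 → (∀ m → mult (1 + m * 2) b ≤ 1) → ∀ m → mult (1 + m * 2) b⁺ ≤ 1
        distinct⁺ e≤1 distinct m with m ≟ j
        ... | yes refl = subst (_≤ 1) (sym here-≡) e≤1
        ... | no  m≢j  = subst (_≤ 1) (sym (there-≡ (1 + m * 2) (m≢j ∘ *-cancelʳ-≡ m j 2 ∘ suc-injective))) (distinct m)
        window< : (∀ m → window m b < k) → e + mult (2 + j * 2) b ≤ i → ∀ m → window m b⁺ < k
        window< windows few m with m ≟ j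
        ... | yes refl = subst (_< k)
          (sym (cong₂ _+_ (trans (there-≡ (j * 2) (odd≢even j j ∘ sym)) (mult-below j<b (m≤n⇒m≤1+n ≤-refl))) last-two)) (≤-<-trans few i<k)
        ... | no m≢j = subst (_< k)
          (sym (cong₂ _+_ (there-≡ (m * 2) (odd≢even j m ∘ sym))
            (cong₂ _+_ (there-≡ (1 + m * 2) (m≢j ∘ *-cancelʳ-≡ m j 2 ∘ suc-injective)) (there-≡ (2 + m * 2) (odd≢even j (suc m) ∘ sym))))) (windows m)

    mutual
      enumD-enumerates : ∀ t j M i → j + t ≡ M → i < k →
        Enumerates (λ b → Shape (1 + j * 2) (M * 2) b × SparseD j i b) (enumD t j i)
      enumD-enumerates zero j M i j≡M i<k = enumerates-[] (SparseD j i)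
        (s≤s (≤-reflexive (cong (_* 2) (trans (sym j≡M) (+-identityʳ j)))))
        (((λ _ → z≤n) , (λ _ → ≤-<-trans z≤n i<k)) , z≤n)
      enumD-enumerates (suc t) j M i j+t≡M i<k = peel-enumerates (1 + j * 2) (λ e → SparseG (suc j) (suc i ∸ e)) (SparseD j i) 2 _
        (≤-trans (n≤1+n (1 + j * 2)) (*-monoˡ-≤ 2 (subst (suc j ≤_) 1+j+t≡M (m≤m+n (suc j) t))))
        (λ e _ → enumG-enumerates t (suc j) M (suc i ∸ e) 1+j+t≡M (≤-trans (m∸n≤m (suc i) e) i<k))
        (λ e b shape → sparse-odd j e b (proj₁ (proj₂ shape)) i<k)
        where
        1+j+t≡M : suc j + t ≡ M
        1+j+t≡M = trans (sym (+-suc j t)) j+t≡M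

      enumG-enumerates : ∀ t j M i → j + t ≡ M → i ≤ k →
        Enumerates (λ b → Shape (j * 2) (M * 2) b × SparseG j i b) (enumG t j i)
      enumG-enumerates t j M i j+t≡M i≤k = peel-enumerates (j * 2) (λ e → SparseD j (k ∸ suc e)) (SparseG j i) i _
        (*-monoˡ-≤ 2 (subst (j ≤_) j+t≡M (m≤m+n j t)))
        (λ e e<i → enumD-enumerates t j M (k ∸ suc e) j+t≡M (∸-monoʳ-< (s≤s z≤n) (≤-trans e<i i≤k)))
        (λ e b shape → let here≡e = mult-snoc-here (j * 2) e b (proj₁ (proj₂ shape))
                           even = λ e<i → sparse-even j e b (proj₁ (proj₂ shape)) (≤-trans e<i i≤k) in mk⇔
          (λ (e<i , P) → Equivalence.to (even e<i) P , subst (_< i) (sym here≡e) e<i)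
          (λ (sparse , few) → let e<i = subst (_< i) here≡e few in e<i , Equivalence.from (even e<i) sparse))

open Enumerations using (peel; odd≢even; module BoundedMultiplicities; module SparsePartitions)

-- Products over residue classes and generating functions of the enumerations

sum-replicate : ∀ e l → sum (replicate e l) ≡ e ℕ.* l
sum-replicate zero    l = ≡.refl
sum-replicate (suc e) l = ≡.cong (l ℕ.+_) (sum-replicate e l)

suc-%-injective : ∀ L .{{_ : NonZero L}} {m r} → m ℕ.< L → r ℕ.< L → suc m % L ≡ suc r % L → m ≡ r
suc-%-injective L {m} {r} m<L r<L eq with ℕₚ.m≤n⇒m<n∨m≡n m<L | ℕₚ.m≤n⇒m<n∨m≡n r<L
... | inj₁ m+1<L | inj₁ r+1<L = ℕₚ.suc-injective (≡.trans (≡.sym (m<n⇒m%n≡m m+1<L)) (≡.trans eq (m<n⇒m%n≡m r+1<L)))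
... | inj₁ m+1<L | inj₂ ≡.refl = contradiction (≡.trans (≡.sym (m<n⇒m%n≡m m+1<L)) (≡.trans eq (n%n≡0 L))) λ ()
... | inj₂ ≡.refl | inj₁ r+1<L = contradiction (≡.trans (≡.sym (m<n⇒m%n≡m r+1<L)) (≡.trans (≡.sym eq) (n%n≡0 L))) λ ()
... | inj₂ ≡.refl | inj₂ m+1≡r+1 = ℕₚ.suc-injective (≡.sym m+1≡r+1)

module GeneratingFunctions (R : CommutativeSemiring 0ℓ 0ℓ)
  (s : CommutativeSemiring.Carrier R)
  (1+s≈0 : CommutativeSemiring._≈_ R (CommutativeSemiring._+_ R (CommutativeSemiring.1# R) s) (CommutativeSemiring.0# R))
  where

  open SignedSemiring R s 1+s≈0
  open ThetaQuotients R s 1+s≈0 using (H; J; H-step; H-zero; J-limit; even-tail)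
  open import Relation.Binary.Reasoning.Setoid setoid
  open import Algebra.Solver.Ring.NaturalCoefficients.Default R using (solve; _:=_; _:+_; _:*_; con)

  when : Bool → Carrier → Carrier
  when c x = if c then x else 1#

  ∏-single : ∀ n g r → r ℕ.< n → (∀ m → m ℕ.< n → m ≢ r → g m ≈ 1#) → ∏ n g ≈ g r
  ∏-single (suc n) g zero _ g≈1 =
    trans (*-congˡ (∏-1 n λ m m<n → g≈1 (suc m) (s≤s m<n) λ ())) (*-identityʳ _)
  ∏-single (suc n) g (suc r) (s≤s r<n) g≈1 =
    trans (*-cong (g≈1 0 (s≤s z≤n) λ ()) (∏-single n (g ∘ suc) r r<n λ m m<n m≢r → g≈1 (suc m) (s≤s m<n) (m≢r ∘ ℕₚ.suc-injective)))
      (*-identityˡ _)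

  -- Each block of L consecutive indices meets the class once, at offset r. Classes are represented
  -- by r + 1 in 1, ..., L because the exponents in the products start at 1; the class of 0 is r + 1
  -- = L.
  ∏-residue : ∀ B L .{{_ : NonZero L}} r → r ℕ.< L → (u : ℕ → Carrier) →
    ∏ (B ℕ.* L) (λ m → when (suc m % L ℕ.≡ᵇ suc r % L) (u (suc m))) ≈ ∏ B (λ b → u (b ℕ.* L ℕ.+ suc r))
  ∏-residue zero    L r r<L u = refl
  ∏-residue (suc B) L r r<L u = begin
    ∏ (L ℕ.+ B ℕ.* L) f
      ≈⟨ ∏-split L (B ℕ.* L) f ⟩
    ∏ L f * ∏ (B ℕ.* L) (λ m → f (L ℕ.+ m))
      ≈⟨ *-cong (∏-single L f r r<L off) (∏-cong (B ℕ.* L) λ m _ → reflexive (shift m)) ⟩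
    f r * ∏ (B ℕ.* L) (λ m → when (suc m % L ℕ.≡ᵇ suc r % L) (u (L ℕ.+ suc m)))
      ≈⟨ *-cong on (∏-residue B L r r<L (u ∘ (L ℕ.+_))) ⟩
    u (suc r) * ∏ B (λ b → u (L ℕ.+ (b ℕ.* L ℕ.+ suc r)))
      ≈⟨ *-congˡ (∏-cong B λ b _ → reflexive (≡.cong u (≡.sym (ℕₚ.+-assoc L (b ℕ.* L) (suc r))))) ⟩
    u (suc r) * ∏ B (λ b → u (L ℕ.+ b ℕ.* L ℕ.+ suc r)) ∎
    where
    f : ℕ → Carrier
    f m = when (suc m % L ℕ.≡ᵇ suc r % L) (u (suc m))
    shift : ∀ m → f (L ℕ.+ m) ≡ when (suc m % L ℕ.≡ᵇ suc r % L) (u (L ℕ.+ suc m))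
    shift m = ≡.cong₂ (λ y x → when (y ℕ.≡ᵇ suc r % L) (u x))
      (≡.trans (≡.cong (λ y → suc y % L) (ℕₚ.+-comm L m)) ([m+n]%n≡m%n (suc m) L)) (≡.sym (ℕₚ.+-suc L m))
    on : f r ≈ u (suc r)
    on with suc r % L ℕ.≡ᵇ suc r % L | ℕₚ.≡⇒≡ᵇ (suc r % L) (suc r % L) ≡.refl
    ... | true | _ = refl
    off : ∀ m → m ℕ.< L → m ≢ r → f m ≈ 1#
    off m m<L m≢r with suc m % L ℕ.≡ᵇ suc r % L | ℕₚ.≡ᵇ⇒≡ (suc m % L) (suc r % L)
    ... | false | _  = refl
    ... | true  | eq = contradiction (suc-%-injective L m<L r<L (eq _)) m≢r

  ∏-pairs : ∀ B f → ∏ (B ℕ.* 2) f ≈ ∏ B (λ b → f (b ℕ.* 2) * f (suc (b ℕ.* 2)))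
  ∏-pairs zero    f = refl
  ∏-pairs (suc B) f = trans (sym (*-assoc _ _ _)) (*-congˡ (∏-pairs B (λ m → f (2 ℕ.+ m))))

  -- At most one of the four conditions holds, so x occurs exactly once on the right. Factoring ∏ (1
  -- - q^y) over the classes in this way replaces dividing it by the excluded classes.
  when-exclusive : ∀ A B C D x → ¬ (T A × T B) → ¬ (T A × T C) → ¬ (T A × T D) → ¬ (T B × T C) → ¬ (T B × T D) → ¬ (T C × T D) →
    x ≈ when (not A ∧ not B ∧ not C ∧ not D) x * (when A x * (when B x * (when C x * when D x)))
  when-exclusive true  true  _     _     x ab _ _ _ _ _ = contradiction _ ab
  when-exclusive true  false true  _     x _ ac _ _ _ _ = contradiction _ ac
  when-exclusive true  false false true  x _ _ ad _ _ _ = contradiction _ ad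
  when-exclusive false true  true  _     x _ _ _ bc _ _ = contradiction _ bc
  when-exclusive false true  false true  x _ _ _ _ bd _ = contradiction _ bd
  when-exclusive false false true  true  x _ _ _ _ _ cd = contradiction _ cd
  when-exclusive true  false false false x _ _ _ _ _ _  = solve 1 (λ x → x := con 1 :* (x :* (con 1 :* (con 1 :* con 1)))) refl x
  when-exclusive false true  false false x _ _ _ _ _ _  = solve 1 (λ x → x := con 1 :* (con 1 :* (x :* (con 1 :* con 1)))) refl x
  when-exclusive false false true  false x _ _ _ _ _ _  = solve 1 (λ x → x := con 1 :* (con 1 :* (con 1 :* (x :* con 1)))) refl x
  when-exclusive false false false true  x _ _ _ _ _ _  = solve 1 (λ x → x := con 1 :* (con 1 :* (con 1 :* (con 1 :* x)))) refl x
  when-exclusive false false false false x _ _ _ _ _ _  = solve 1 (λ x → x := x :* (con 1 :* (con 1 :* (con 1 :* con 1)))) refl x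

  geometric : ∀ n z → 1- z * ∑ n (z ^_) ≈ 1- (z ^ n)
  geometric zero    z = trans (zeroʳ _) (sym (trans (+-congˡ (*-identityʳ s)) 1+s≈0))
  geometric (suc n) z = begin
    1- z * ∑ (suc n) (z ^_)               ≈⟨ *-congˡ (∑-last n (z ^_)) ⟩
    1- z * (∑ n (z ^_) + z ^ n)           ≈⟨ distribˡ _ _ _ ⟩
    1- z * ∑ n (z ^_) + 1- z * z ^ n      ≈⟨ +-congʳ (geometric n z) ⟩
    1- (z ^ n) + 1- z * z ^ n             ≈⟨ solve 3 (λ s z y → con 1 :+ s :* y :+ (con 1 :+ s :* z) :* y := con 1 :+ s :* (z :* y) :+ (y :+ s :* y)) refl s z (z ^ n) ⟩
    1- (z * z ^ n) + (z ^ n + s * z ^ n)  ≈⟨ trans (+-congˡ (x+sx≈0 (z ^ n))) (+-identityʳ _) ⟩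
    1- (z ^ suc n)                        ∎

  module _ (q : Carrier) where

    GF : List (List ℕ) → Carrier
    GF []       = 0#
    GF (b ∷ xs) = q ^ sum b + GF xs

    GF-++ : ∀ xs ys → GF (xs ++ ys) ≈ GF xs + GF ys
    GF-++ []       ys = sym (+-identityˡ _)
    GF-++ (b ∷ xs) ys = trans (+-congˡ (GF-++ xs ys)) (sym (+-assoc _ _ _))

    GF-snoc : ∀ e l xs → GF (map (_++ replicate e l) xs) ≈ (q ^ l) ^ e * GF xs
    GF-snoc e l []       = sym (zeroʳ _)
    GF-snoc e l (b ∷ xs) = trans (+-cong weight (GF-snoc e l xs)) (sym (distribˡ _ _ _))
      where
      weight : q ^ sum (b ++ replicate e l) ≈ (q ^ l) ^ e * q ^ sum b
      weight = begin
        q ^ sum (b ++ replicate e l)            ≡⟨ ≡.cong (q ^_) (sum-++ b (replicate e l)) ⟩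
        q ^ (sum b ℕ.+ sum (replicate e l))     ≈⟨ ^-homo-* q (sum b) _ ⟩
        q ^ sum b * q ^ sum (replicate e l)     ≡⟨ ≡.cong (λ m → q ^ sum b * q ^ m) (≡.trans (sum-replicate e l) (ℕₚ.*-comm e l)) ⟩
        q ^ sum b * q ^ (l ℕ.* e)               ≈⟨ *-congˡ (^-assocʳ q l e) ⟨
        q ^ sum b * (q ^ l) ^ e                 ≈⟨ *-comm _ _ ⟩
        (q ^ l) ^ e * q ^ sum b                 ∎

    GF-peel-suc : ∀ l K E → GF (peel l (suc K) E) ≈ GF (peel l K E) + (q ^ l) ^ K * GF (E K)
    GF-peel-suc l K E = trans (GF-++ (peel l K E) _) (+-congˡ (GF-snoc K l (E K)))

    GF-peel : ∀ l K E → GF (peel l K E) ≈ ∑ K (λ e → (q ^ l) ^ e * GF (E e))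
    GF-peel l zero    E = refl
    GF-peel l (suc K) E = trans (GF-peel-suc l K E) (trans (+-congʳ (GF-peel l K E)) (sym (∑-last K (λ e → (q ^ l) ^ e * GF (E e)))))

    q^[m*2] : ∀ m → q ^ (m ℕ.* 2) ≈ (q * q) ^ m
    q^[m*2] zero    = refl
    q^[m*2] (suc m) = trans (*-congˡ (*-congˡ (q^[m*2] m))) (sym (*-assoc _ _ _))

    module _ (N : ℕ) (q^N≈0 : q ^ N ≈ 0#) where

      module _ (cap : ℕ → ℕ) (0<cap : ∀ y → 0 ℕ.< cap y) (u : ℕ → Carrier)
        (u*geometric : ∀ y → u (suc y) * ∑ (cap (suc y)) ((q ^ suc y) ^_) ≈ 1#) where

        open BoundedMultiplicities cap 0<cap

        -- Euler's product with the reciprocals on the left: `u y` inverts the truncated geometric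
        -- series that records the copies of the part y.
        ∏*GF-enumCapped : ∀ t m → ∏ t (λ r → u (suc m ℕ.+ r)) * GF (enumCapped t m) ≈ 1#
        ∏*GF-enumCapped zero    m = trans (*-identityˡ _) (+-identityʳ 1#)
        ∏*GF-enumCapped (suc t) m = begin
          u (suc m ℕ.+ 0) * ∏ t (λ r → u (suc m ℕ.+ suc r)) * GF (enumCapped (suc t) m)
            ≈⟨ *-cong (*-cong (reflexive (≡.cong u (ℕₚ.+-identityʳ (suc m)))) (∏-cong t λ r _ → reflexive (≡.cong u (ℕₚ.+-suc (suc m) r))))
                 (trans (GF-peel (suc m) (cap (suc m)) (λ _ → enumCapped t (suc m)))
                   (trans (∑-cong (cap (suc m)) λ _ _ → *-comm _ _) (sym (∑-*ˡ (cap (suc m)) _ _)))) ⟩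
          u (suc m) * F * (G * S)
            ≈⟨ solve 4 (λ u F G S → u :* F :* (G :* S) := u :* S :* (F :* G)) refl (u (suc m)) F G S ⟩
          u (suc m) * S * (F * G)
            ≈⟨ *-cong (u*geometric m) (∏*GF-enumCapped t (suc m)) ⟩
          1# * 1#
            ≈⟨ *-identityˡ 1# ⟩
          1# ∎
          where
          F G S : Carrier
          F = ∏ t (λ r → u (suc (suc m) ℕ.+ r))
          G = GF (enumCapped t (suc m))
          S = ∑ (cap (suc m)) ((q ^ suc m) ^_)

      module _ (k′ : ℕ) where

        private
          k : ℕ
          k = suc k′
          E : Carrier
          E = even-tail q N q^N≈0 k 0
        open SparsePartitions k

        mutual
          -- `E` is the factor (p;p)_∞ that cleared the denominators of `H` and `J`. The bound N ≤ j
          -- + t ensures that where the enumeration stops, p^j is already 0 and `J-limit` applies.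
          GF-enumD : ∀ t j i′ c → N ℕ.≤ j ℕ.+ t → suc (i′ ℕ.+ c) ≡ k →
            GF (enumD t j i′) * E ≈ J q N q^N≈0 k j i′ c
          GF-enumD zero j i′ c N≤ i′+1+c≡k = trans (trans (*-congʳ (+-identityʳ 1#)) (*-identityˡ _))
            (sym (J-limit q N q^N≈0 k ≡.refl j i′ c (≡.subst (N ℕ.≤_) (ℕₚ.+-identityʳ j) N≤)))
          GF-enumD (suc t) j i′ c N≤ i′+1+c≡k = begin
            GF (enumD (suc t) j i′) * E
              ≈⟨ *-congʳ (GF-peel (1 ℕ.+ j ℕ.* 2) 2 (λ e → enumG t (suc j) (suc i′ ℕ.∸ e))) ⟩
            (1# * G₁ + (q * q ^ (j ℕ.* 2) * 1# * G₀ + 0#)) * E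
              ≈⟨ *-congʳ (+-congˡ (+-congʳ (*-congʳ (*-congʳ (*-congˡ (q^[m*2] j)))))) ⟩
            (1# * G₁ + (q * (q * q) ^ j * 1# * G₀ + 0#)) * E
              ≈⟨ solve 5 (λ g₁ g₀ q x e → (con 1 :* g₁ :+ (q :* x :* con 1 :* g₀ :+ con 0)) :* e := g₁ :* e :+ x :* q :* (g₀ :* e)) refl G₁ G₀ q ((q * q) ^ j) E ⟩
            G₁ * E + (q * q) ^ j * q * (G₀ * E)
              ≈⟨ +-cong (GF-enumG t j (suc i′) c N≤′ i′+1+c≡k) (*-congˡ (GF-enumG t j i′ (suc c) N≤′ (≡.trans (ℕₚ.+-suc i′ c) i′+1+c≡k))) ⟩
            J q N q^N≈0 k j i′ c ∎
            where
            G₀ G₁ : Carrier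
            G₀ = GF (enumG t (suc j) i′)
            G₁ = GF (enumG t (suc j) (suc i′))
            N≤′ : N ℕ.≤ suc j ℕ.+ t
            N≤′ = ≡.subst (N ℕ.≤_) (ℕₚ.+-suc j t) N≤

          -- `enumG` is taken at `suc j` because `H` with parameter j has the argument p^(j+1). One
          -- more copy of the smallest part is `H-step`, in which i and c change places: i copies
          -- leave the bound k - 1 - i for the next two part sizes.
          GF-enumG : ∀ t j i c → N ℕ.≤ suc j ℕ.+ t → i ℕ.+ c ≡ k →
            GF (enumG t (suc j) i) * E ≈ H q N q^N≈0 k j i c
          GF-enumG t j zero    c N≤ ≡.refl  = trans (zeroˡ _) (sym (H-zero q N q^N≈0 k j))
          GF-enumG t j (suc i) c N≤ i+1+c≡k = begin
            GF (enumG t (suc j) (suc i)) * E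
              ≈⟨ *-congʳ (GF-peel-suc (suc j ℕ.* 2) i (λ e → enumD t (suc j) (k ℕ.∸ suc e))) ⟩
            (GF (enumG t (suc j) i) + (q ^ (suc j ℕ.* 2)) ^ i * GF (enumD t (suc j) (k ℕ.∸ suc i))) * E
              ≈⟨ *-congʳ (+-congˡ (*-cong (^-congˡ i (q^[m*2] (suc j))) (reflexive (≡.cong (GF ∘ enumD t (suc j)) k∸1+i≡c)))) ⟩
            (GF (enumG t (suc j) i) + X ^ i * GF (enumD t (suc j) c)) * E
              ≈⟨ solve 4 (λ g x d e → (g :+ x :* d) :* e := g :* e :+ x :* (d :* e)) refl (GF (enumG t (suc j) i)) (X ^ i) (GF (enumD t (suc j) c)) E ⟩
            GF (enumG t (suc j) i) * E + X ^ i * (GF (enumD t (suc j) c) * E)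
              ≈⟨ +-cong (GF-enumG t j i (suc c) N≤ (≡.trans (ℕₚ.+-suc i c) i+1+c≡k))
                   (*-congˡ (GF-enumD t (suc j) c i N≤ (≡.trans (≡.cong suc (ℕₚ.+-comm c i)) i+1+c≡k))) ⟩
            H q N q^N≈0 k j i (suc c) + X ^ i * J q N q^N≈0 k (suc j) c i
              ≈⟨ H-step q N q^N≈0 k i c i+1+c≡k j ⟨
            H q N q^N≈0 k j (suc i) c ∎
            where
            X : Carrier
            X = (q * q) ^ suc j
            k∸1+i≡c : k ℕ.∸ suc i ≡ c
            k∸1+i≡c = ≡.trans (≡.cong (ℕ._∸ suc i) (≡.sym i+1+c≡k)) (ℕₚ.m+n∸m≡n (suc i) c)

-- Arithmetic of the excluded residue classes

module Arithmetic where
  open ℕSolver.+-*-Solver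

  4*k≡k*2*2 : ∀ k → 4 ℕ.* k ≡ k ℕ.* 2 ℕ.* 2
  4*k≡k*2*2 = solve 1 (λ k → con 4 :* k := k :* con 2 :* con 2) ≡.refl

  k+k≡k*2 : ∀ k → k ℕ.+ k ≡ k ℕ.* 2
  k+k≡k*2 = solve 1 (λ k → k :+ k := k :* con 2) ≡.refl

  N*4k≡N*k*2*2 : ∀ N k → N ℕ.* (4 ℕ.* k) ≡ N ℕ.* k ℕ.* 2 ℕ.* 2
  N*4k≡N*k*2*2 = solve 2 (λ N k → N :* (con 4 :* k) := N :* k :* con 2 :* con 2) ≡.refl

  [k+k]*2*n≡n*4k : ∀ k n → (k ℕ.+ k) ℕ.* 2 ℕ.* n ≡ n ℕ.* (4 ℕ.* k)
  [k+k]*2*n≡n*4k = solve 2 (λ k n → (k :+ k) :* con 2 :* n := n :* (con 4 :* k)) ≡.refl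

  [1+b+b]*2≡b*4+2 : ∀ b → suc (b ℕ.+ b) ℕ.* 2 ≡ b ℕ.* 4 ℕ.+ 2
  [1+b+b]*2≡b*4+2 = solve 1 (λ b → (con 1 :+ (b :+ b)) :* con 2 := b :* con 4 :+ con 2) ≡.refl

  2k+1+2i≡1+[k+i]*2 : ∀ k i → 2 ℕ.* k ℕ.+ suc (i ℕ.* 2) ≡ suc ((k ℕ.+ i) ℕ.* 2)
  2k+1+2i≡1+[k+i]*2 = solve 2 (λ k i → con 2 :* k :+ (con 1 :+ i :* con 2) := con 1 :+ (k :+ i) :* con 2) ≡.refl

  2[1+c+i]+1≡2[1+i]+1+2c : ∀ c i → 2 ℕ.* suc (c ℕ.+ i) ℕ.+ 1 ≡ 2 ℕ.* suc i ℕ.+ suc (c ℕ.* 2)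
  2[1+c+i]+1≡2[1+i]+1+2c = solve 2 (λ c i → con 2 :* (con 1 :+ (c :+ i)) :+ con 1 := con 2 :* (con 1 :+ i) :+ (con 1 :+ c :* con 2)) ≡.refl

open Arithmetic

module Residues (c i₁ : ℕ) where

  k L : ℕ
  k = suc (c ℕ.+ i₁)
  L = 4 ℕ.* k

  -- Predecessors of the excluded residues 4k, 2k + (2i - 1) and 2k - (2i - 1), where c = k - i and
  -- i₁ = i - 1.
  r₀ r₊ r₋ : ℕ
  r₀ = ℕ.pred L
  r₊ = (k ℕ.+ i₁) ℕ.* 2
  r₋ = c ℕ.* 2

  L≡[k*2]*2 : L ≡ (k ℕ.* 2) ℕ.* 2
  L≡[k*2]*2 = 4*k≡k*2*2 k

  r₊<L : r₊ ℕ.< L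
  r₊<L = ≡.subst (r₊ ℕ.<_) (≡.sym L≡[k*2]*2) (ℕₚ.*-monoˡ-< 2 (≡.subst (k ℕ.+ i₁ ℕ.<_) (k+k≡k*2 k) (ℕₚ.+-monoʳ-< k (s≤s (ℕₚ.m≤n+m i₁ c)))))

  c<k+i₁ : c ℕ.< k ℕ.+ i₁
  c<k+i₁ = ℕₚ.≤-trans (s≤s (ℕₚ.m≤m+n c i₁)) (ℕₚ.m≤m+n k i₁)

  r₋<r₊ : r₋ ℕ.< r₊
  r₋<r₊ = ℕₚ.*-monoˡ-< 2 c<k+i₁

  r₋<L : r₋ ℕ.< L
  r₋<L = ℕₚ.<-trans r₋<r₊ r₊<L

  residue : ℕ → ℕ → Bool
  residue r y = y % L ℕ.≡ᵇ suc r % L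

  allowed-residues : ∀ y → allowedPart k (suc i₁) y ≡
    not (y % 4 ℕ.≡ᵇ 2) ∧ not (residue r₀ y) ∧ not (residue r₊ y) ∧ not (residue r₋ y)
  allowed-residues y = ≡.cong₂ (λ d e → not (y % 4 ℕ.≡ᵇ 2) ∧ not (y % L ℕ.≡ᵇ d) ∧ e) (≡.sym (n%n≡0 L))
    (≡.cong₂ (λ d e → not (y % L ℕ.≡ᵇ d % L) ∧ not (y % L ℕ.≡ᵇ e)) plus (≡.trans minus (≡.sym (m<n⇒m%n≡m suc-r₋<L))))
    where
    plus : 2 ℕ.* k ℕ.+ (2 ℕ.* suc i₁ ℕ.∸ 1) ≡ suc r₊
    plus = ≡.trans (≡.cong (λ t → 2 ℕ.* k ℕ.+ (t ℕ.∸ 1)) (ℕₚ.*-comm 2 (suc i₁))) (2k+1+2i≡1+[k+i]*2 k i₁)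
    minus : 2 ℕ.* k ℕ.+ 1 ℕ.∸ 2 ℕ.* suc i₁ ≡ suc r₋
    minus = ≡.trans (≡.cong (ℕ._∸ 2 ℕ.* suc i₁) (2[1+c+i]+1≡2[1+i]+1+2c c i₁))
      (ℕₚ.m+n∸m≡n (2 ℕ.* suc i₁) (suc r₋))
    suc-r₋<L : suc r₋ ℕ.< L
    suc-r₋<L = ℕₚ.≤-<-trans r₋<r₊ r₊<L

  residue-exclusive : ∀ {r r′} y → r ℕ.< L → r′ ℕ.< L → r ≢ r′ → ¬ (T (residue r y) × T (residue r′ y))
  residue-exclusive {r} {r′} y r<L r′<L r≢r′ (y≡r , y≡r′) =
    r≢r′ (suc-%-injective L r<L r′<L (≡.trans (≡.sym (ℕₚ.≡ᵇ⇒≡ (y % L) _ y≡r)) (ℕₚ.≡ᵇ⇒≡ (y % L) _ y≡r′)))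

  -- As 4 divides L, the residue modulo L determines the residue modulo 4. The three excluded
  -- classes modulo L are 0 or odd modulo 4, so they are disjoint from the class of 2.
  residue-not-2 : ∀ r y → suc r % 4 ≢ 2 → ¬ (T (y % 4 ℕ.≡ᵇ 2) × T (residue r y))
  residue-not-2 r y r≢2 (y≡2 , y≡r) = r≢2 (≡.trans (≡.sym (mod4 (suc r)))
    (≡.trans (≡.cong (_% 4) (≡.sym (ℕₚ.≡ᵇ⇒≡ (y % L) _ y≡r))) (≡.trans (mod4 y) (ℕₚ.≡ᵇ⇒≡ (y % 4) 2 y≡2))))
    where
    mod4 : ∀ x → x % L % 4 ≡ x % 4
    mod4 x = m∣n⇒o%n%m≡o%m 4 L x (divides k (ℕₚ.*-comm 4 k))

  odd%4≢2 : ∀ m → suc (m ℕ.* 2) % 4 ≢ 2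
  odd%4≢2 m eq = contradiction (≡.trans (≡.sym ([m+kn]%n≡m%n 1 m 2)) (≡.trans (≡.sym (m∣n⇒o%n%m≡o%m 2 4 (suc (m ℕ.* 2)) (divides 2 ≡.refl))) (≡.cong (_% 2) eq))) λ ()

  L%4≢2 : L % 4 ≢ 2
  L%4≢2 eq = contradiction (≡.trans (≡.sym (≡.trans (≡.cong (_% 4) (ℕₚ.*-comm 4 k)) (m*n%n≡0 k 4))) eq) λ ()

  r₀≢even : ∀ m → r₀ ≢ m ℕ.* 2
  r₀≢even m eq = odd≢even m (k ℕ.* 2) (≡.trans (≡.cong suc (≡.sym eq)) L≡[k*2]*2)

-- Equality of the two generating functions

module ProductIdentity (R : CommutativeSemiring 0ℓ 0ℓ)
  (s : CommutativeSemiring.Carrier R)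
  (1+s≈0 : CommutativeSemiring._≈_ R (CommutativeSemiring._+_ R (CommutativeSemiring.1# R) s) (CommutativeSemiring.0# R))
  where

  open SignedSemiring R s 1+s≈0
  open JacobiTripleProduct R s 1+s≈0 using (theta; jacobi-triple-product)
  open ThetaQuotients R s 1+s≈0 using (J-theta; even-tail; odd-tail; even-∏≈tail; odd-∏≈tail; z; w; z*w≈p^k*p^k; z^N≈0; w^N≈0)
  open GeneratingFunctions R s 1+s≈0
  open import Relation.Binary.Reasoning.Setoid setoid
  open import Algebra.Solver.Ring.NaturalCoefficients.Default R using (solve; _:=_; _:+_; _:*_; con)

  module _ (q : Carrier) (N : ℕ) (0<N : 0 ℕ.< N) (q^N≈0 : q ^ N ≈ 0#) (c i₁ : ℕ) where

    open Residues c i₁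

    -- Cutting ∏ (1 - q^m) at M = 4kN makes the progressions with steps L, 4 and 2 fill whole
    -- blocks: N, kN and B = 2kN of them.
    M B : ℕ
    B = N ℕ.* k ℕ.* 2
    M = N ℕ.* L

    p : Carrier
    p = q * q

    N≤N*k : N ℕ.≤ N ℕ.* k
    N≤N*k = ℕₚ.m≤m*n N k

    N≤B : N ℕ.≤ B
    N≤B = ℕₚ.≤-trans N≤N*k (ℕₚ.m≤m*n (N ℕ.* k) 2)

    -- A part of a partition of n < N occurs fewer than N times.
    cap : ℕ → ℕ
    cap y = if allowedPart k (suc i₁) y then N else 1

    0<cap : ∀ y → 0 ℕ.< cap y
    0<cap y with allowedPart k (suc i₁) y
    ... | true  = 0<N
    ... | false = s≤s z≤n

    factor : ℕ → Carrier
    factor y = when (allowedPart k (suc i₁) y) (1- (q ^ y))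

    euler-factor : ∀ y → 1- (q ^ suc y) * ∑ N ((q ^ suc y) ^_) ≈ 1#
    euler-factor y = trans (geometric N (q ^ suc y)) (1+0*x s (*-^-zero {q} {N} (q ^ y) q^N≈0))

    allowed-euler-factor : ∀ y → factor (suc y) * ∑ (cap (suc y)) ((q ^ suc y) ^_) ≈ 1#
    allowed-euler-factor y with allowedPart k (suc i₁) (suc y)
    ... | true  = euler-factor y
    ... | false = trans (*-identityˡ _) (+-identityʳ 1#)

    factor-split : ∀ y → 1- (q ^ y) ≈ factor y * (when (y % 4 ℕ.≡ᵇ 2) (1- (q ^ y)) *
      (when (residue r₀ y) (1- (q ^ y)) * (when (residue r₊ y) (1- (q ^ y)) * when (residue r₋ y) (1- (q ^ y)))))
    factor-split y = trans
      (when-exclusive (y % 4 ℕ.≡ᵇ 2) (residue r₀ y) (residue r₊ y) (residue r₋ y) _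
        (residue-not-2 r₀ y L%4≢2) (residue-not-2 r₊ y (odd%4≢2 (k ℕ.+ i₁))) (residue-not-2 r₋ y (odd%4≢2 c))
        (residue-exclusive y ℕₚ.≤-refl r₊<L (r₀≢even (k ℕ.+ i₁))) (residue-exclusive y ℕₚ.≤-refl r₋<L (r₀≢even c))
        (residue-exclusive y r₊<L r₋<L (ℕₚ.>⇒≢ r₋<r₊)))
      (*-congʳ (reflexive (≡.cong (λ a → when a (1- (q ^ y))) (≡.sym (allowed-residues y)))))

    progression : ℕ → ℕ → ℕ → Carrier
    progression n m r = ∏ n (λ b → 1- (q ^ (b ℕ.* m ℕ.+ suc r)))

    F U : Carrier
    F = ∏ M (λ m → factor (suc m))
    U = ∏ M (λ m → 1- (q ^ suc m))

    U-residues : U ≈ F * (progression (N ℕ.* k) 4 1 * (progression N L r₀ * (progression N L r₊ * progression N L r₋)))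
    U-residues = begin
      U
        ≈⟨ ∏-cong M (λ m _ → factor-split (suc m)) ⟩
      ∏ M (λ m → factor (suc m) * (two (suc m) * (v r₀ (suc m) * (v r₊ (suc m) * v r₋ (suc m)))))
        ≈⟨ trans (∏-* M _ _) (*-congˡ (trans (∏-* M _ _) (*-congˡ (trans (∏-* M _ _) (*-congˡ (∏-* M _ _)))))) ⟩
      F * (∏ M (two ∘ suc) * (∏ M (v r₀ ∘ suc) * (∏ M (v r₊ ∘ suc) * ∏ M (v r₋ ∘ suc))))
        ≈⟨ *-congˡ (*-cong (trans (reflexive (≡.cong (λ n → ∏ n (two ∘ suc)) M≡[N*k]*4)) (∏-residue (N ℕ.* k) 4 1 (s≤s (s≤s z≤n)) (λ y → 1- (q ^ y))))
             (*-cong (∏-residue N L r₀ ℕₚ.≤-refl (λ y → 1- (q ^ y))) (*-cong (∏-residue N L r₊ r₊<L (λ y → 1- (q ^ y))) (∏-residue N L r₋ r₋<L (λ y → 1- (q ^ y)))))) ⟩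
      F * (progression (N ℕ.* k) 4 1 * (progression N L r₀ * (progression N L r₊ * progression N L r₋))) ∎
      where
      two : ℕ → Carrier
      two y = when (y % 4 ℕ.≡ᵇ 2) (1- (q ^ y))
      v : ℕ → ℕ → Carrier
      v r y = when (residue r y) (1- (q ^ y))
      M≡[N*k]*4 : M ≡ N ℕ.* k ℕ.* 4
      M≡[N*k]*4 = ≡.trans (≡.cong (N ℕ.*_) (ℕₚ.*-comm 4 k)) (≡.sym (ℕₚ.*-assoc N k 4))

    z₀ w₀ θ : Carrier
    z₀ = z q N q^N≈0 k c i₁ ≡.refl
    w₀ = w q N q^N≈0 k c i₁ ≡.refl
    θ  = theta z₀ w₀ N (z^N≈0 q N q^N≈0 k c i₁ ≡.refl) (w^N≈0 q N q^N≈0 k c i₁ ≡.refl)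

    [z₀*w₀]^n : ∀ n → (z₀ * w₀) ^ n ≈ q ^ (n ℕ.* L)
    [z₀*w₀]^n n = begin
      (z₀ * w₀) ^ n                ≈⟨ ^-congˡ n (z*w≈p^k*p^k q N q^N≈0 k c i₁ ≡.refl) ⟩
      (p ^ k * p ^ k) ^ n          ≈⟨ ^-congˡ n (^-homo-* p k k) ⟨
      (p ^ (k ℕ.+ k)) ^ n          ≈⟨ ^-congˡ n (q^[m*2] q (k ℕ.+ k)) ⟨
      (q ^ ((k ℕ.+ k) ℕ.* 2)) ^ n  ≈⟨ ^-assocʳ q ((k ℕ.+ k) ℕ.* 2) n ⟩
      q ^ ((k ℕ.+ k) ℕ.* 2 ℕ.* n)  ≡⟨ ≡.cong (q ^_) ([k+k]*2*n≡n*4k k n) ⟩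
      q ^ (n ℕ.* L)                ∎

    progression-linear : ∀ {x} r → x ≈ s * q ^ suc r → ∏ N (λ m → 1# + x * (z₀ * w₀) ^ m) ≈ progression N L r
    progression-linear {x} r x≈ = ∏-cong N λ m _ → +-congˡ (begin
      x * (z₀ * w₀) ^ m                ≈⟨ *-cong x≈ ([z₀*w₀]^n m) ⟩
      s * q ^ suc r * q ^ (m ℕ.* L)    ≈⟨ solve 3 (λ s a b → s :* a :* b := s :* (b :* a)) refl s (q ^ suc r) (q ^ (m ℕ.* L)) ⟩
      s * (q ^ (m ℕ.* L) * q ^ suc r)  ≈⟨ *-congˡ (^-homo-* q (m ℕ.* L) (suc r)) ⟨
      s * q ^ (m ℕ.* L ℕ.+ suc r)      ∎)

    θ-progressions : θ ≈ progression N L r₀ * (progression N L r₊ * progression N L r₋)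
    θ-progressions = begin
      θ
        ≈⟨ jacobi-triple-product z₀ w₀ N (z^N≈0 q N q^N≈0 k c i₁ ≡.refl) (w^N≈0 q N q^N≈0 k c i₁ ≡.refl) ⟩
      ∏ N (λ m → 1- ((z₀ * w₀) ^ suc m)) * ∏ N (λ m → 1# + z₀ * (z₀ * w₀) ^ m) * ∏ N (λ m → 1# + w₀ * (z₀ * w₀) ^ m)
        ≈⟨ *-cong (*-cong (∏-cong N λ m _ → +-congˡ (*-congˡ (trans ([z₀*w₀]^n (suc m)) (reflexive (≡.cong (q ^_) (ℕₚ.+-comm L (m ℕ.* L)))))))
             (progression-linear r₊ z₀≈)) (progression-linear r₋ w₀≈) ⟩
      progression N L r₀ * progression N L r₊ * progression N L r₋
        ≈⟨ *-assoc _ _ _ ⟩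
      progression N L r₀ * (progression N L r₊ * progression N L r₋) ∎
      where
      z₀≈ : z₀ ≈ s * q ^ suc r₊
      z₀≈ = trans (*-congˡ (*-congˡ (trans (sym (^-homo-* p k i₁)) (sym (q^[m*2] q (k ℕ.+ i₁))))))
        (solve 3 (λ q s x → q :* (s :* x) := s :* (q :* x)) refl q s (q ^ r₊))
      w₀≈ : w₀ ≈ s * q ^ suc r₋
      w₀≈ = trans (*-congˡ (*-congˡ (sym (q^[m*2] q c))))
        (solve 3 (λ q s x → q :* (s :* x) := s :* (q :* x)) refl q s (q ^ r₋))

    E O : Carrier
    E = even-tail q N q^N≈0 k 0
    O = odd-tail q N q^N≈0 k 0

    odd-product : Carrier
    odd-product = ∏ B (λ b → 1- (q * p ^ b))

    U-parity : U ≈ odd-product * E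
    U-parity = begin
      U
        ≡⟨ ≡.cong (λ n → ∏ n (λ m → 1- (q ^ suc m))) M≡B*2 ⟩
      ∏ (B ℕ.* 2) (λ m → 1- (q ^ suc m))
        ≈⟨ ∏-pairs B _ ⟩
      ∏ B (λ b → 1- (q ^ suc (b ℕ.* 2)) * 1- (q ^ suc (suc (b ℕ.* 2))))
        ≈⟨ ∏-cong B (λ b _ → *-cong (+-congˡ (*-congˡ (*-congˡ (q^[m*2] q b)))) (+-congˡ (*-congˡ (q^[m*2] q (suc b))))) ⟩
      ∏ B (λ b → 1- (q * p ^ b) * 1- (p ^ suc b))
        ≈⟨ trans (∏-* B _ _) (*-congˡ (even-∏≈tail q N q^N≈0 k B N≤B)) ⟩
      odd-product * E ∎
      where
      M≡B*2 : M ≡ B ℕ.* 2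
      M≡B*2 = N*4k≡N*k*2*2 N k

    -- The class of 2 modulo 4 arises here, from (1 + q^(2b+1)) (1 - q^(2b+1)) = 1 - q^(4b+2). The
    -- first factors come from `J` at x = 1, the second from the odd exponents in `U`.
    O*odd-product : O * odd-product ≈ progression (N ℕ.* k) 4 1
    O*odd-product = begin
      O * odd-product
        ≈⟨ *-congʳ (odd-∏≈tail q N q^N≈0 k B N≤B) ⟨
      ∏ B (λ b → 1# + q * p ^ b) * odd-product
        ≈⟨ ∏-* B _ _ ⟨
      ∏ B (λ b → (1# + q * p ^ b) * 1- (q * p ^ b))
        ≈⟨ ∏-cong B (λ b _ → trans (difference-of-squares (q * p ^ b)) (+-congˡ (*-congˡ (square b)))) ⟩
      ∏ B (λ b → 1- (q ^ (b ℕ.* 4 ℕ.+ 2)))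
        ≡⟨ ≡.cong (λ n → ∏ n (λ b → 1- (q ^ (b ℕ.* 4 ℕ.+ 2)))) (≡.trans (ℕₚ.*-comm (N ℕ.* k) 2) (≡.cong (N ℕ.* k ℕ.+_) (ℕₚ.+-identityʳ (N ℕ.* k)))) ⟩
      ∏ (N ℕ.* k ℕ.+ N ℕ.* k) (λ b → 1- (q ^ (b ℕ.* 4 ℕ.+ 2)))
        -- The second half of the factors has exponents of at least N and is trivial.
        ≈⟨ ∏-support (N ℕ.* k) (N ℕ.* k) _ (λ r N*k≤r → 1+0*x s (^-zero q^N≈0 _
             (ℕₚ.≤-trans N≤N*k (ℕₚ.≤-trans N*k≤r (ℕₚ.≤-trans (ℕₚ.m≤m*n r 4) (ℕₚ.m≤m+n (r ℕ.* 4) 2)))))) ⟩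
      progression (N ℕ.* k) 4 1 ∎
      where
      difference-of-squares : ∀ x → (1# + x) * 1- x ≈ 1- (x * x)
      difference-of-squares x = begin
        (1# + x) * (1# + s * x)        ≈⟨ solve 2 (λ s x → (con 1 :+ x) :* (con 1 :+ s :* x) := con 1 :+ s :* (x :* x) :+ (x :+ s :* x)) refl s x ⟩
        1# + s * (x * x) + (x + s * x) ≈⟨ trans (+-congˡ (x+sx≈0 x)) (+-identityʳ _) ⟩
        1# + s * (x * x)               ∎
      square : ∀ b → q * p ^ b * (q * p ^ b) ≈ q ^ (b ℕ.* 4 ℕ.+ 2)
      square b = begin
        q * p ^ b * (q * p ^ b)   ≈⟨ solve 2 (λ q x → q :* x :* (q :* x) := q :* q :* (x :* x)) refl q (p ^ b) ⟩
        p * (p ^ b * p ^ b)       ≈⟨ *-congˡ (^-homo-* p b b) ⟨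
        p ^ suc (b ℕ.+ b)         ≈⟨ q^[m*2] q (suc (b ℕ.+ b)) ⟨
        q ^ (suc (b ℕ.+ b) ℕ.* 2) ≡⟨ ≡.cong (q ^_) ([1+b+b]*2≡b*4+2 b) ⟩
        q ^ (b ℕ.* 4 ℕ.+ 2)       ∎

    open BoundedMultiplicities cap 0<cap using (enumCapped)
    open SparsePartitions k using (enumD)
    private module Unrestricted = BoundedMultiplicities (λ _ → N) (λ _ → 0<N)

    -- Both sides times `U` give the same product `W`, and `U` may be cancelled because it is a
    -- unit: its inverse `V` is the generating function of the partitions with parts up to M and any
    -- multiplicities below N.
    GF-enumCapped≈GF-enumD : GF q (enumCapped M 0) ≈ GF q (enumD N 0 c)
    GF-enumCapped≈GF-enumD = begin
      A                ≈⟨ trans (sym (*-identityʳ A)) (*-congˡ (sym U*V≈1)) ⟩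
      A * (U * V)      ≈⟨ *-assoc _ _ _ ⟨
      A * U * V        ≈⟨ *-congʳ (trans A*U≈ (sym D*U≈)) ⟩
      D * U * V        ≈⟨ *-assoc _ _ _ ⟩
      D * (U * V)      ≈⟨ trans (*-congˡ U*V≈1) (*-identityʳ D) ⟩
      D                ∎
      where
      A D V W : Carrier
      A = GF q (enumCapped M 0)
      D = GF q (enumD N 0 c)
      V = GF q (Unrestricted.enumCapped M 0)
      W = progression (N ℕ.* k) 4 1 * θ
      U*V≈1 : U * V ≈ 1#
      U*V≈1 = ∏*GF-enumCapped q N q^N≈0 (λ _ → N) (λ _ → 0<N) (λ y → 1- (q ^ y)) euler-factor M 0
      A*U≈ : A * U ≈ W
      A*U≈ = begin
        A * U        ≈⟨ *-congˡ (trans U-residues (*-congˡ (*-congˡ (sym θ-progressions)))) ⟩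
        A * (F * W)  ≈⟨ solve 3 (λ a f w → a :* (f :* w) := f :* a :* w) refl A F W ⟩
        F * A * W    ≈⟨ trans (*-congʳ (∏*GF-enumCapped q N q^N≈0 cap 0<cap factor allowed-euler-factor M 0)) (*-identityˡ W) ⟩
        W            ∎
      D*U≈ : D * U ≈ W
      D*U≈ = begin
        D * U                    ≈⟨ *-congˡ U-parity ⟩
        D * (odd-product * E)    ≈⟨ solve 3 (λ d o e → d :* (o :* e) := d :* e :* o) refl D odd-product E ⟩
        -- The bound c = k - i on the parts 1 and 2 is the index c + 1 of `J`. So c takes the place
        -- of i′ here, and i₁ that of the complementary exponent.
        D * E * odd-product      ≈⟨ *-congʳ (trans (GF-enumD q N q^N≈0 (c ℕ.+ i₁) N 0 c i₁ ℕₚ.≤-refl ≡.refl) (J-theta q N q^N≈0 k c i₁ ≡.refl)) ⟩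
        O * θ * odd-product      ≈⟨ solve 3 (λ a b c → a :* b :* c := a :* c :* b) refl O θ odd-product ⟩
        O * odd-product * θ      ≈⟨ *-congʳ O*odd-product ⟩
        W                        ∎

-- Integer power series modulo q^N

module PowerSeries (N : ℕ) where

  open import Level using (0ℓ)
  open import Algebra.Bundles using (CommutativeSemiring)
  open import Data.Integer as ℤ using (ℤ; 0ℤ; 1ℤ; -1ℤ)
  import Data.Integer.Properties as ℤₚ
  open import Data.Integer.Solver using (module +-*-Solver)
  open import Data.Nat as ℕ using (ℕ; zero; suc; _<_; z≤n; s≤s)
  import Data.Nat.Properties as ℕₚ
  open import Data.Product using (_,_)
  open import Function using (_∘_)
  open import Relation.Binary.PropositionalEquality using (_≡_; _≢_; refl; sym; trans; cong; cong₂)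
  open import Relation.Nullary using (contradiction)
  open +-*-Solver using (solve; _:=_; _:+_; _:*_)

  Series : Set
  Series = ℕ → ℤ

  infix  4 _≈_
  infixl 6 _⊕_
  infixl 7 _⊛_

  -- The reduction modulo q^N sits in the equality alone; coefficient sequences are not cut off, so
  -- the multiplication needs no bounds.
  _≈_ : Series → Series → Set
  f ≈ g = ∀ n → n < N → f n ≡ g n

  𝟘 : Series
  𝟘 _ = 0ℤ

  constant : ℤ → Series
  constant c zero    = c
  constant c (suc n) = 0ℤ

  -- The product follows the decomposition f = f(0) + q · (f ∘ suc), so that its laws can be proved
  -- by induction on the index of the coefficient.
  _⊕_ _⊛_ : Series → Series → Series
  (f ⊕ g) n = f n ℤ.+ g n
  (f ⊛ g) zero    = f 0 ℤ.* g 0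
  (f ⊛ g) (suc n) = f 0 ℤ.* g (suc n) ℤ.+ (f ∘ suc ⊛ g) n

  ⊛-cong : ∀ n {f f′ g g′} → (∀ m → m ℕ.≤ n → f m ≡ f′ m) → (∀ m → m ℕ.≤ n → g m ≡ g′ m) → (f ⊛ g) n ≡ (f′ ⊛ g′) n
  ⊛-cong zero    f≈ g≈ = cong₂ ℤ._*_ (f≈ 0 z≤n) (g≈ 0 z≤n)
  ⊛-cong (suc n) f≈ g≈ = cong₂ ℤ._+_ (cong₂ ℤ._*_ (f≈ 0 z≤n) (g≈ (suc n) ℕₚ.≤-refl))
    (⊛-cong n (λ m m≤n → f≈ (suc m) (s≤s m≤n)) (λ m m≤n → g≈ m (ℕₚ.m≤n⇒m≤1+n m≤n)))

  ⊛-distribʳ : ∀ n f g h → ((f ⊕ g) ⊛ h) n ≡ (f ⊛ h) n ℤ.+ (g ⊛ h) n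
  ⊛-distribʳ zero    f g h = ℤₚ.*-distribʳ-+ (h 0) (f 0) (g 0)
  ⊛-distribʳ (suc n) f g h = trans (cong (ℤ._+_ ((f ⊕ g) 0 ℤ.* h (suc n))) (⊛-distribʳ n (f ∘ suc) (g ∘ suc) h))
    (solve 5 (λ a b c x y → (a :+ b) :* c :+ (x :+ y) := a :* c :+ x :+ (b :* c :+ y)) refl (f 0) (g 0) (h (suc n)) _ _)

  scale : ℤ → Series → Series
  scale c f n = c ℤ.* f n

  ⊛-scale : ∀ n c f g → (scale c f ⊛ g) n ≡ c ℤ.* (f ⊛ g) n
  ⊛-scale zero    c f g = ℤₚ.*-assoc c (f 0) (g 0)
  ⊛-scale (suc n) c f g = trans (cong (ℤ._+_ (c ℤ.* f 0 ℤ.* g (suc n))) (⊛-scale n c (f ∘ suc) g))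
    (solve 4 (λ c a b x → c :* a :* b :+ c :* x := c :* (a :* b :+ x)) refl c (f 0) (g (suc n)) _)

  ⊛-assoc : ∀ n f g h → ((f ⊛ g) ⊛ h) n ≡ (f ⊛ (g ⊛ h)) n
  ⊛-assoc zero    f g h = ℤₚ.*-assoc (f 0) (g 0) (h 0)
  ⊛-assoc (suc n) f g h = trans
    (cong (ℤ._+_ (f 0 ℤ.* g 0 ℤ.* h (suc n))) (trans (⊛-distribʳ n (scale (f 0) (g ∘ suc)) (f ∘ suc ⊛ g) h)
      (cong₂ ℤ._+_ (⊛-scale n (f 0) (g ∘ suc) h) (⊛-assoc n (f ∘ suc) g h))))
    (solve 5 (λ a b c x y → a :* b :* c :+ (a :* x :+ y) := a :* (b :* c :+ x) :+ y) refl (f 0) (g 0) (h (suc n)) _ _)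

  ⊛-sucʳ : ∀ n f g → (f ⊛ g) (suc n) ≡ f (suc n) ℤ.* g 0 ℤ.+ (f ⊛ (g ∘ suc)) n
  ⊛-sucʳ zero    f g = ℤₚ.+-comm (f 0 ℤ.* g 1) (f 1 ℤ.* g 0)
  ⊛-sucʳ (suc n) f g = trans (cong (ℤ._+_ (f 0 ℤ.* g (2 ℕ.+ n))) (⊛-sucʳ n (f ∘ suc) g))
    (solve 3 (λ a b c → a :+ (b :+ c) := b :+ (a :+ c)) refl (f 0 ℤ.* g (suc (suc n))) (f (suc (suc n)) ℤ.* g 0) _)

  ⊛-comm : ∀ n f g → (f ⊛ g) n ≡ (g ⊛ f) n
  ⊛-comm zero    f g = ℤₚ.*-comm (f 0) (g 0)
  ⊛-comm (suc n) f g = trans (⊛-sucʳ n f g) (cong₂ ℤ._+_ (ℤₚ.*-comm (f (suc n)) (g 0)) (⊛-comm n f (g ∘ suc)))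

  ⊛-zeroˡ : ∀ n f → (𝟘 ⊛ f) n ≡ 0ℤ
  ⊛-zeroˡ zero    f = refl
  ⊛-zeroˡ (suc n) f = trans (ℤₚ.+-identityˡ _) (⊛-zeroˡ n f)

  ⊛-constantˡ : ∀ n c f → (constant c ⊛ f) n ≡ c ℤ.* f n
  ⊛-constantˡ zero    c f = refl
  ⊛-constantˡ (suc n) c f = trans (cong (ℤ._+_ (c ℤ.* f (suc n))) (⊛-zeroˡ n f)) (ℤₚ.+-identityʳ _)

  series : CommutativeSemiring 0ℓ 0ℓ
  series = record
    { Carrier = Series ; _≈_ = _≈_ ; _+_ = _⊕_ ; _*_ = _⊛_ ; 0# = 𝟘 ; 1# = constant 1ℤ
    ; isCommutativeSemiring = record
      { isSemiring = record
        { isSemiringWithoutAnnihilatingZero = record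
          { +-isCommutativeMonoid = record
            { isMonoid = record
              { isSemigroup = record
                { isMagma = record
                  { isEquivalence = record { refl = λ _ _ → refl ; sym = λ e n n< → sym (e n n<) ; trans = λ e e′ n n< → trans (e n n<) (e′ n n<) }
                  ; ∙-cong = λ e e′ n n< → cong₂ ℤ._+_ (e n n<) (e′ n n<) }
                ; assoc = λ f g h n _ → ℤₚ.+-assoc (f n) (g n) (h n) }
              ; identity = (λ f n _ → ℤₚ.+-identityˡ (f n)) , (λ f n _ → ℤₚ.+-identityʳ (f n)) }
            ; comm = λ f g n _ → ℤₚ.+-comm (f n) (g n) }
          ; *-cong = λ e e′ n n< → ⊛-cong n (λ m m≤n → e m (ℕₚ.≤-<-trans m≤n n<)) (λ m m≤n → e′ m (ℕₚ.≤-<-trans m≤n n<))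
          ; *-assoc = λ f g h n _ → ⊛-assoc n f g h
          ; *-identity = (λ f n _ → 1-identityˡ n f) , (λ f n _ → trans (⊛-comm n f (constant 1ℤ)) (1-identityˡ n f))
          ; distrib = (λ f g h n _ → trans (⊛-comm n f (g ⊕ h)) (trans (⊛-distribʳ n g h f) (cong₂ ℤ._+_ (⊛-comm n g f) (⊛-comm n h f)))) ,
                      (λ f g h n _ → ⊛-distribʳ n g h f) }
        ; zero = (λ f n _ → ⊛-zeroˡ n f) , (λ f n _ → trans (⊛-comm n f 𝟘) (⊛-zeroˡ n f)) }
      ; *-comm = λ f g n _ → ⊛-comm n f g } }
    where
    1-identityˡ : ∀ n f → (constant 1ℤ ⊛ f) n ≡ f n
    1-identityˡ n f = trans (⊛-constantˡ n 1ℤ f) (ℤₚ.*-identityˡ (f n))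

  1+[-1]≈0 : constant 1ℤ ⊕ constant -1ℤ ≈ 𝟘
  1+[-1]≈0 zero    _ = refl
  1+[-1]≈0 (suc n) _ = refl

  q : Series
  q zero    = 0ℤ
  q (suc n) = constant 1ℤ n

  open import Algebra.Properties.Semiring.Exp (CommutativeSemiring.semiring series) using (_^_)

  q⊛-suc : ∀ f n → (q ⊛ f) (suc n) ≡ f n
  q⊛-suc f n = trans (ℤₚ.+-identityˡ _) (trans (⊛-constantˡ n 1ℤ f) (ℤₚ.*-identityˡ (f n)))

  q^-coefficient : ∀ m n → m ≡ n → (q ^ m) n ≡ 1ℤ
  q^-coefficient zero    .zero    refl = refl
  q^-coefficient (suc m) .(suc m) refl = trans (q⊛-suc (q ^ m) m) (q^-coefficient m m refl)

  q^-coefficient-0 : ∀ m n → m ≢ n → (q ^ m) n ≡ 0ℤ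
  q^-coefficient-0 zero    zero    m≢n = contradiction refl m≢n
  q^-coefficient-0 zero    (suc n) m≢n = refl
  q^-coefficient-0 (suc m) zero    m≢n = refl
  q^-coefficient-0 (suc m) (suc n) m≢n = trans (q⊛-suc (q ^ m) n) (q^-coefficient-0 m n (m≢n ∘ cong suc))

  q^N≈0 : q ^ N ≈ 𝟘
  q^N≈0 n n<N = q^-coefficient-0 N n (λ N≡n → ℕₚ.<⇒≢ n<N (sym N≡n))

-- The Boolean conditions as bounds on multiplicities

module DefiningConditions where

  open import Data.Bool using (true; false; T; _∧_; not)
  open import Data.Bool.Properties using (T-∧)
  open import Data.List using ([]; _∷_)
  open import Data.List.Relation.Unary.All as All using (All; []; _∷_)
  open import Data.List.Relation.Unary.AllPairs as AllPairs using (AllPairs; []; _∷_)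
  open import Data.Nat using (ℕ; zero; suc; s≤s⁻¹; _+_; _*_; _≤_; _<_; _≥_; z≤n; s≤s; _≡ᵇ_; _≤ᵇ_; _≟_; _≤?_)
  open import Data.Nat.ListAction using (sum)
  open import Data.Nat.Properties hiding (_≟_; _≤?_)
  open import Data.Product using (_×_; _,_; proj₁; proj₂; ∃-syntax)
  open import Function using (_∘_; _⇔_; mk⇔; Equivalence)
  open import Relation.Binary.PropositionalEquality using (_≡_; _≢_; refl; sym; trans; cong; cong₂; subst)
  open import Relation.Nullary using (yes; no; contradiction)
  open Enumerations
  open Equivalence using (to; from)

  all⇔All : ∀ P b → T (all P b) ⇔ All (T ∘ P) b
  all⇔All P b = mk⇔ (⇒ b) (⇐ b)
    where
    ⇒ : ∀ b → T (all P b) → All (T ∘ P) b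
    ⇒ []       _  = []
    ⇒ (x ∷ xs) ok = let Px , Pxs = to T-∧ ok in Px ∷ ⇒ xs Pxs
    ⇐ : ∀ b → All (T ∘ P) b → T (all P b)
    ⇐ []       _          = _
    ⇐ (x ∷ xs) (Px ∷ Pxs) = from T-∧ (Px , ⇐ xs Pxs)

  decreasing⇔AllPairs : ∀ b → T (decreasing b) ⇔ AllPairs _≥_ b
  decreasing⇔AllPairs b = mk⇔ (⇒ b) (⇐ b)
    where
    prepend : ∀ {x y xs} → y ≤ x → AllPairs _≥_ (y ∷ xs) → AllPairs _≥_ (x ∷ y ∷ xs)
    prepend y≤x (y≥xs ∷ xs↘) = (y≤x ∷ All.map (λ z≤y → ≤-trans z≤y y≤x) y≥xs) ∷ y≥xs ∷ xs↘
    ⇒ : ∀ b → T (decreasing b) → AllPairs _≥_ b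
    ⇒ []           _  = []
    ⇒ (x ∷ [])     _  = [] ∷ []
    ⇒ (x ∷ y ∷ xs) ok = let y≤x , ok′ = to (T-∧ {y ≤ᵇ x}) ok in prepend (≤ᵇ⇒≤ y x y≤x) (⇒ (y ∷ xs) ok′)
    ⇐ : ∀ b → AllPairs _≥_ b → T (decreasing b)
    ⇐ []           _                    = _
    ⇐ (x ∷ [])     _                    = _
    ⇐ (x ∷ y ∷ xs) ((y≤x ∷ _) ∷ xs↘) = from T-∧ (≤⇒≤ᵇ y≤x , ⇐ (y ∷ xs) xs↘)

  isPartition⇔ : ∀ n b → T (isPartition n b) ⇔ (All (1 ≤_) b × AllPairs _≥_ b × sum b ≡ n)
  isPartition⇔ n b = mk⇔
    (λ ok → let pos , ok′ = to (T-∧ {all (1 ≤ᵇ_) b}) ok ; dec , total = to (T-∧ {decreasing b}) ok′ in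
      All.map (≤ᵇ⇒≤ 1 _) (to (all⇔All (1 ≤ᵇ_) b) pos) , to (decreasing⇔AllPairs b) dec , ≡ᵇ⇒≡ _ _ total)
    (λ (pos , dec , total) → from T-∧ (from (all⇔All (1 ≤ᵇ_) b) (All.map ≤⇒≤ᵇ pos) ,
      from T-∧ (from (decreasing⇔AllPairs b) dec , ≡⇒≡ᵇ _ _ total)))

  parts≤sum : ∀ b → All (_≤ sum b) b
  parts≤sum []       = []
  parts≤sum (x ∷ xs) = m≤m+n x (sum xs) ∷ All.map (λ y≤ → ≤-trans y≤ (m≤n+m (sum xs) x)) (parts≤sum xs)

  mult≤suc : ∀ y x xs → mult y (x ∷ xs) ≤ suc (mult y xs)
  mult≤suc y x xs with x ≡ᵇ y
  ... | true  = ≤-refl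
  ... | false = n≤1+n _

  mult≤mult-∷ : ∀ y x xs → mult y xs ≤ mult y (x ∷ xs)
  mult≤mult-∷ y x xs = m≤n+m (mult y xs) _

  mult≤sum : ∀ y b → All (1 ≤_) b → mult y b ≤ sum b
  mult≤sum y []       _            = z≤n
  mult≤sum y (x ∷ xs) (1≤x ∷ 1≤xs) = ≤-trans (mult≤suc y x xs) (+-mono-≤ 1≤x (mult≤sum y xs 1≤xs))

  -- For b_p = x with Bottom x m, the gap condition says b_{p+k-1} < 2m.
  data Bottom : ℕ → ℕ → Set where
    odd-bottom  : ∀ m → odd (1 + m * 2) ≡ true → Bottom (1 + m * 2) m
    even-bottom : ∀ m → odd (2 + m * 2) ≡ false → Bottom (2 + m * 2) m

  bottom : ∀ x → 1 ≤ x → ∃[ m ] Bottom x m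
  bottom 1 _ = 0 , odd-bottom 0 refl
  bottom 2 _ = 0 , even-bottom 0 refl
  bottom (suc (suc (suc x))) _ with bottom (suc x) (s≤s z≤n)
  ... | m , odd-bottom .m eq  = suc m , odd-bottom (suc m) eq
  ... | m , even-bottom .m eq = suc m , even-bottom (suc m) eq

  odd-suc-double : ∀ m → odd (1 + m * 2) ≡ true
  odd-suc-double zero    = refl
  odd-suc-double (suc m) = odd-suc-double m

  noRepeatedOdd⇔ : ∀ b → All (1 ≤_) b → AllPairs _≥_ b → T (noRepeatedOdd b) ⇔ (∀ m → mult (1 + m * 2) b ≤ 1)
  noRepeatedOdd⇔ b b>0 b↘ = mk⇔ (⇒ b b↘) (⇐ b b>0)
    where
    ⇒ : ∀ b → AllPairs _≥_ b → T (noRepeatedOdd b) → ∀ m → mult (1 + m * 2) b ≤ 1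
    ⇒ []           _ _ m = z≤n
    ⇒ (x ∷ [])     _ _ m = mult≤suc (1 + m * 2) x []
    ⇒ (x ∷ y ∷ xs) ((y≤x ∷ _) ∷ y≥xs ∷ xs↘) ok m
      with x ≟ 1 + m * 2 | ⇒ (y ∷ xs) (y≥xs ∷ xs↘) (proj₂ (to (T-∧ {not (odd x ∧ (x ≡ᵇ y))}) ok)) m
    ... | no x≢    | few = subst (_≤ 1) (sym (mult-there (y ∷ xs) x≢)) few
    ... | yes refl | _   = ≤-reflexive (trans (mult-here x (y ∷ xs)) (cong suc (mult-absent x (y ∷ xs) (All.map <⇒≢ (y<x ∷ All.map (λ z≤y → ≤-<-trans z≤y y<x) y≥xs)))))
      where
      differ : ∀ {o} → o ≡ true → T (not (o ∧ (x ≡ᵇ y))) → x ≢ y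
      differ refl x≠y x≡y with x ≡ᵇ y | ≡⇒≡ᵇ x y x≡y
      ... | true | _ = x≠y
      y<x : y < x
      y<x = ≤∧≢⇒< y≤x (differ (odd-suc-double m) (proj₁ (to T-∧ ok)) ∘ sym)
    ⇐ : ∀ b → All (1 ≤_) b → (∀ m → mult (1 + m * 2) b ≤ 1) → T (noRepeatedOdd b)
    ⇐ []           _ _ = _
    ⇐ (x ∷ [])     _ _ = _
    ⇐ (x ∷ y ∷ xs) (1≤x ∷ b>0) few = from T-∧ (head , ⇐ (y ∷ xs) b>0 (λ m → ≤-trans (mult≤mult-∷ (1 + m * 2) x (y ∷ xs)) (few m)))
      where
      head : T (not (odd x ∧ (x ≡ᵇ y)))
      head with bottom x 1≤x
      ... | m , even-bottom .m eq rewrite eq = _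
      ... | m , odd-bottom .m eq rewrite eq with x ≡ᵇ y | ≡ᵇ⇒≡ x y
      ... | false | _ = _
      ... | true | x≡y with x≡y _
      ... | refl = contradiction (few m) (<⇒≱ (subst (1 <_) (sym (trans (mult-here x (x ∷ xs)) (cong suc (mult-here x xs)))) (s≤s (s≤s z≤n))))

  module _ (k′ : ℕ) where

    open SparsePartitions (suc k′)

    window≤window-∷ : ∀ m x xs → window m xs ≤ window m (x ∷ xs)
    window≤window-∷ m x xs = +-mono-≤ (mult≤mult-∷ (m * 2) x xs) (+-mono-≤ (mult≤mult-∷ (1 + m * 2) x xs) (mult≤mult-∷ (2 + m * 2) x xs))

    window-in : ∀ m x xs → m * 2 ≤ x → x ≤ 2 + m * 2 → window m (x ∷ xs) ≡ suc (window m xs)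
    window-in m x xs 2m≤x x≤2+2m with x ≟ m * 2 | x ≟ 1 + m * 2 | x ≟ 2 + m * 2
    ... | yes refl | _ | _ = cong₂ _+_ (mult-here x xs) (cong₂ _+_ (mult-there xs (<⇒≢ ≤-refl)) (mult-there xs (<⇒≢ (n≤1+n _))))
    ... | no x≢₀ | yes refl | _ = trans (cong₂ _+_ (mult-there xs x≢₀) (cong₂ _+_ (mult-here x xs) (mult-there xs (<⇒≢ ≤-refl)))) (+-suc _ _)
    ... | no x≢₀ | no x≢₁ | yes refl = trans (cong₂ _+_ (mult-there xs x≢₀) (trans (cong₂ _+_ (mult-there xs x≢₁) (mult-here x xs)) (+-suc _ _))) (+-suc _ _)
    ... | no x≢₀ | no x≢₁ | no x≢₂ = contradiction (≤∧≢⇒< (≤∧≢⇒< (≤∧≢⇒< 2m≤x (x≢₀ ∘ sym)) (x≢₁ ∘ sym)) (x≢₂ ∘ sym)) (≤⇒≯ x≤2+2m)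

    window-below : ∀ m b → All (_< m * 2) b → window m b ≡ 0
    window-below m b b<2m = cong₂ _+_ (mult-absent _ b (All.map <⇒≢ b<2m))
      (cong₂ _+_ (mult-absent _ b (All.map (<⇒≢ ∘ m≤n⇒m≤1+n) b<2m)) (mult-absent _ b (All.map (<⇒≢ ∘ m≤n⇒m≤1+n ∘ m≤n⇒m≤1+n) b<2m)))

    window-above : ∀ m x xs → 2 + m * 2 < x → window m (x ∷ xs) ≡ window m xs
    window-above m x xs 2+2m<x = cong₂ _+_ (mult-there xs (>⇒≢ (<-trans ≤-refl (<-trans ≤-refl 2+2m<x))))
      (cong₂ _+_ (mult-there xs (>⇒≢ (<-trans ≤-refl 2+2m<x))) (mult-there xs (>⇒≢ 2+2m<x)))

    window≤suc : ∀ m x xs → window m (x ∷ xs) ≤ suc (window m xs)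
    window≤suc m x xs with m * 2 ≤? x | x ≤? 2 + m * 2
    ... | yes 2m≤x | yes x≤2+2m = ≤-reflexive (window-in m x xs 2m≤x x≤2+2m)
    ... | _        | no  x≰2+2m = ≤-trans (≤-reflexive (window-above m x xs (≰⇒> x≰2+2m))) (n≤1+n _)
    ... | no 2m≰x  | yes _      = ≤-trans (≤-reflexive (cong₂ _+_ (mult-there xs (<⇒≢ x<2m)) (cong₂ _+_ (mult-there xs (<⇒≢ (m≤n⇒m≤1+n x<2m)))
        (mult-there xs (<⇒≢ (m≤n⇒m≤1+n (m≤n⇒m≤1+n x<2m))))))) (n≤1+n _)
      where
      x<2m : x < m * 2
      x<2m = ≰⇒> 2m≰x

    -- If entry j of a decreasing list is missing or below 2m, so is everything after it, and only
    -- the j entries before it can lie in the window.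
    index-small⇒window≤ : ∀ m j b → AllPairs _≥_ b → (∀ y → index b j ≡ (true , y) → y < m * 2) → window m b ≤ j
    index-small⇒window≤ m j []       _ _ = z≤n
    index-small⇒window≤ m zero (x ∷ xs) (x≥xs ∷ _) small =
      ≤-reflexive (window-below m (x ∷ xs) (small x refl ∷ All.map (λ y≤x → ≤-<-trans y≤x (small x refl)) x≥xs))
    index-small⇒window≤ m (suc j) (x ∷ xs) (_ ∷ xs↘) small = ≤-trans (window≤suc m x xs) (s≤s (index-small⇒window≤ m j xs xs↘ small))

    index-All : ∀ {P : ℕ → Set} b j {y} → All P b → index b j ≡ (true , y) → P y
    index-All (x ∷ xs) zero    (Px ∷ _)  refl = Px
    index-All (x ∷ xs) (suc j) (_ ∷ Pxs) eq   = index-All xs j Pxs eq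

    -- The entries 0, ..., j all lie between entry j and 2m + 2, which puts j + 1 entries in the
    -- window.
    index-large⇒<window : ∀ m j b {y} → AllPairs _≥_ b → All (_≤ 2 + m * 2) b → index b j ≡ (true , y) → m * 2 ≤ y → j < window m b
    index-large⇒<window m zero (x ∷ xs) _ (x≤ ∷ _) refl 2m≤x = subst (0 <_) (sym (window-in m x xs 2m≤x x≤)) (s≤s z≤n)
    index-large⇒<window m (suc j) (x ∷ xs) (x≥xs ∷ xs↘) (x≤ ∷ xs≤) eq 2m≤y =
      subst (suc j <_) (sym (window-in m x xs (≤-trans 2m≤y (index-All xs j x≥xs eq)) x≤)) (s≤s (index-large⇒<window m j xs xs↘ xs≤ eq 2m≤y))

    headDiff⇔ : ∀ x xs m → Bottom x m → T (headDiff (suc k′) (x ∷ xs)) ⇔ (∀ y → index (x ∷ xs) k′ ≡ (true , y) → y < m * 2)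
    headDiff⇔ .(1 + m * 2) xs m (odd-bottom .m eq) with index (1 + m * 2 ∷ xs) k′
    ... | false , _ = mk⇔ (λ _ y ()) _
    ... | true  , y rewrite eq = mk⇔ (λ { ok .y refl → s≤s⁻¹ (subst (_≤ 1 + m * 2) (+-comm y 2) (≤ᵇ⇒≤ (y + 2) _ ok)) })
      (λ small → ≤⇒≤ᵇ (subst (_≤ 1 + m * 2) (+-comm 2 y) (s≤s (small y refl))))
    headDiff⇔ .(2 + m * 2) xs m (even-bottom .m eq) with index (2 + m * 2 ∷ xs) k′
    ... | false , _ = mk⇔ (λ _ y ()) _
    ... | true  , y rewrite eq = mk⇔ (λ { ok .y refl → s≤s⁻¹ (s≤s⁻¹ (subst (_< 2 + m * 2) (+-comm y 2) (<ᵇ⇒< (y + 2) _ ok))) })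
      (λ small → <⇒<ᵇ (subst (_< 2 + m * 2) (+-comm 2 y) (s≤s (s≤s (small y refl)))))

    bottom≤ : ∀ {x m′ m} → Bottom x m′ → x ≤ 2 + m * 2 → m′ * 2 ≤ m * 2
    bottom≤ {m = m} (odd-bottom m′ _)  x≤ = *-monoˡ-≤ 2 (s≤s⁻¹ (*-cancelʳ-< 2 m′ (suc m) x≤))
    bottom≤         (even-bottom m′ _) x≤ = s≤s⁻¹ (s≤s⁻¹ x≤)

    ≤bottom : ∀ {x m} → Bottom x m → x ≤ 2 + m * 2
    ≤bottom (odd-bottom m _)  = n≤1+n _
    ≤bottom (even-bottom m _) = ≤-refl

    -- For a given m only the first part x ≤ 2m + 2 matters: its bottom m′ is at most m, so the gap
    -- condition at x pushes the part k - 1 places later below 2m. Conversely, the condition at x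
    -- follows from the window at the bottom of x, since no later part exceeds x.
    diffCond⇔ : ∀ b → All (1 ≤_) b → AllPairs _≥_ b → T (diffCond (suc k′) b) ⇔ (∀ m → window m b < suc k′)
    diffCond⇔ b b>0 b↘ = mk⇔ (λ ok m → s≤s (⇒ b b>0 b↘ ok m)) (λ few → ⇐ b b>0 b↘ (λ m → s≤s⁻¹ (few m)))
      where
      ⇒ : ∀ b → All (1 ≤_) b → AllPairs _≥_ b → T (diffCond (suc k′) b) → ∀ m → window m b ≤ k′
      ⇒ []       _ _ _ m = z≤n
      ⇒ (x ∷ xs) (1≤x ∷ xs>0) (x≥xs ∷ xs↘) ok m with to (T-∧ {headDiff (suc k′) (x ∷ xs)}) ok | bottom x 1≤x | x ≤? 2 + m * 2
      ... | _ , ok′   | _           | no x≰   = subst (_≤ k′) (sym (window-above m x xs (≰⇒> x≰))) (⇒ xs xs>0 xs↘ ok′ m)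
      ... | head , _  | m′ , m′-bot | yes x≤  = index-small⇒window≤ m k′ (x ∷ xs) (x≥xs ∷ xs↘)
        (λ y eq → <-≤-trans (to (headDiff⇔ x xs m′ m′-bot) head y eq) (bottom≤ {m = m} m′-bot x≤))
      ⇐ : ∀ b → All (1 ≤_) b → AllPairs _≥_ b → (∀ m → window m b ≤ k′) → T (diffCond (suc k′) b)
      ⇐ []       _ _ _ = _
      ⇐ (x ∷ xs) (1≤x ∷ xs>0) (x≥xs ∷ xs↘) few with bottom x 1≤x
      ... | m , m-bot = from T-∧
        (from (headDiff⇔ x xs m m-bot) (λ y eq → ≰⇒> λ 2m≤y → ≤⇒≯ (few m)
          (index-large⇒<window m k′ (x ∷ xs) (x≥xs ∷ xs↘) (≤bottom {x} {m} m-bot ∷ All.map (λ y≤x → ≤-trans y≤x (≤bottom {x} {m} m-bot)) x≥xs) eq 2m≤y)) ,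
         ⇐ xs xs>0 xs↘ (λ j → ≤-trans (window≤window-∷ j x xs) (few j)))

    countOneTwo≡ : ∀ b → countOneTwo b ≡ mult 1 b + mult 2 b
    countOneTwo≡ [] = refl
    countOneTwo≡ (0 ∷ xs) = countOneTwo≡ xs
    countOneTwo≡ (1 ∷ xs) = cong suc (countOneTwo≡ xs)
    countOneTwo≡ (2 ∷ xs) = trans (cong suc (countOneTwo≡ xs)) (sym (+-suc _ _))
    countOneTwo≡ (suc (suc (suc x)) ∷ xs) = countOneTwo≡ xs

    gap-conditions⇔ : ∀ i b → All (1 ≤_) b → AllPairs _≥_ b →
      T (noRepeatedOdd b ∧ diffCond (suc k′) b ∧ (countOneTwo b ≤ᵇ i)) ⇔ SparseD 0 i b
    gap-conditions⇔ i b b>0 b↘ = mk⇔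
      (λ ok → let nr , ok′ = to (T-∧ {noRepeatedOdd b}) ok ; dc , c≤ = to (T-∧ {diffCond (suc k′) b}) ok′ in
        (to (noRepeatedOdd⇔ b b>0 b↘) nr , to (diffCond⇔ b b>0 b↘) dc) , subst (_≤ i) (countOneTwo≡ b) (≤ᵇ⇒≤ _ i c≤))
      (λ ((distinct , windows) , few) → from T-∧ (from (noRepeatedOdd⇔ b b>0 b↘) distinct ,
        from T-∧ (from (diffCond⇔ b b>0 b↘) windows , ≤⇒≤ᵇ (subst (_≤ i) (sym (countOneTwo≡ b)) few))))

-- Comparison of coefficients and the bijection

module Bijections where

  open import Data.Bool using (Bool; true; false; T; _∧_; if_then_else_)
  open import Data.Bool.Properties using (T-irrelevant)
  open import Data.Fin using (Fin; zero; suc)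
  open import Data.Integer as ℤ using (-1ℤ)
  import Data.Integer.Properties as ℤₚ
  open import Data.List using (List; []; _∷_; length; lookup; filter)
  open import Data.List.Properties using (filter-accept; filter-reject)
  open import Data.List.Membership.Propositional using (_∈_)
  open import Data.List.Membership.Propositional.Properties using (∈-filter⁺; ∈-filter⁻; ∈-lookup)
  open import Data.List.Relation.Unary.All as All using (All; []; _∷_)
  open import Data.List.Relation.Unary.AllPairs using (_∷_)
  open import Data.List.Relation.Unary.Any as Any using (here; there)
  open import Data.List.Relation.Unary.Any.Properties using (lookup-index)
  open import Data.List.Relation.Unary.Unique.Propositional using (Unique)
  import Data.List.Relation.Unary.Unique.Propositional.Properties as Uniqueₚ
  open import Data.Nat as ℕ using (ℕ; zero; suc; _+_; _*_; _∸_; _≤_; _<_; z≤n; s≤s; _≟_; NonZero)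
  open import Data.Nat.ListAction using (sum)
  import Data.Nat.Properties as ℕₚ
  open import Data.Product using (Σ; _×_; _,_; proj₁; proj₂; ∃-syntax)
  open import Function using (_∘_; Equivalence)
  open import Function.Bundles using (_↔_; mk↔ₛ′)
  open import Function.Properties.Inverse using (↔-trans; ↔-sym)
  open import Relation.Binary.PropositionalEquality using (_≡_; refl; sym; trans; cong; cong₂; subst)
  open import Relation.Nullary using (yes; no; contradiction)
  open Equivalence using (to; from)
  open Enumerations
  open DefiningConditions

  lookup-injective : ∀ {A : Set} {xs : List A} → Unique xs → ∀ {i j} → lookup xs i ≡ lookup xs j → i ≡ j
  lookup-injective (x≢xs ∷ xs!) {zero}  {zero}  _  = refl
  lookup-injective (x≢xs ∷ xs!) {zero}  {suc j} eq = contradiction eq (All.lookup x≢xs (∈-lookup j))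
  lookup-injective (x≢xs ∷ xs!) {suc i} {zero}  eq = contradiction (sym eq) (All.lookup x≢xs (∈-lookup i))
  lookup-injective (x≢xs ∷ xs!) {suc i} {suc j} eq = cong suc (lookup-injective xs! eq)

  enumerated↔Fin : ∀ {A B : Set} (f : A → B) xs → (∀ {x y} → f x ≡ f y → x ≡ y) → Unique xs →
    (∀ a → f a ∈ xs) → (∀ {b} → b ∈ xs → ∃[ a ] f a ≡ b) → A ↔ Fin (length xs)
  enumerated↔Fin {A} {B} f xs f-inj xs! f∈ surj = mk↔ₛ′ (λ a → Any.index (f∈ a)) element
    (λ i → lookup-injective xs! (trans (sym (lookup-index (f∈ (element i)))) (f-element i)))
    (λ a → f-inj (trans (f-element _) (sym (lookup-index (f∈ a)))))
    where
    element : Fin (length xs) → A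
    element i = proj₁ (surj (∈-lookup i))
    f-element : ∀ i → f (element i) ≡ lookup xs i
    f-element i = proj₂ (surj (∈-lookup i))

  subset↔Fin : ∀ {n} (P : List ℕ → Bool) xs → Unique xs →
    (∀ {b} → T (isPartition n b) → T (P b) → b ∈ xs) →
    (∀ {b} → b ∈ xs → T (isPartition n b) × T (P b)) →
    Σ (Partition n) (λ b → T (P (proj₁ b))) ↔ Fin (length xs)
  subset↔Fin P xs xs! complete sound = enumerated↔Fin (proj₁ ∘ proj₁) xs injective xs!
    (λ ((b , partition) , Pb) → complete partition Pb)
    (λ {b} b∈ → let partition , Pb = sound b∈ in ((b , partition) , Pb) , refl)
    where
    injective : ∀ {x y} → proj₁ (proj₁ x) ≡ proj₁ (proj₁ y) → x ≡ y
    injective {(b , p) , o} {(.b , p′) , o′} refl = cong₂ (λ p o → (b , p) , o) (T-irrelevant p p′) (T-irrelevant o o′)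

  ofSum : ℕ → List (List ℕ) → List (List ℕ)
  ofSum n = filter (λ b → sum b ≟ n)

  module _ (N : ℕ) where
    open PowerSeries N
    open GeneratingFunctions series (constant -1ℤ) 1+[-1]≈0 using (GF)

    GF-coefficient : ∀ n xs → GF q xs n ≡ ℤ.+ length (ofSum n xs)
    GF-coefficient n []       = refl
    GF-coefficient n (b ∷ xs) with sum b ≟ n
    ... | yes sum≡n = trans (cong₂ ℤ._+_ (q^-coefficient (sum b) n sum≡n) (GF-coefficient n xs))
      (cong (λ ys → ℤ.+ length ys) (sym (filter-accept (λ b → sum b ≟ n) {x = b} {xs = xs} sum≡n)))
    ... | no  sum≢n = trans (cong₂ ℤ._+_ (q^-coefficient-0 (sum b) n sum≢n) (GF-coefficient n xs))
      (trans (ℤₚ.+-identityˡ _) (cong (λ ys → ℤ.+ length ys) (sym (filter-reject (λ b → sum b ≟ n) {x = b} {xs = xs} sum≢n))))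

  module _ (c i₁ n : ℕ) where

    private
      k i N M : ℕ
      k = suc (c + i₁)
      i = suc i₁
      N = suc n
      M = N * (4 * k)

      cap : ℕ → ℕ
      cap y = if allowedPart k i y then N else 1

    open PowerSeries N using (series; constant; q; q^N≈0; 1+[-1]≈0)
    module Identity = ProductIdentity series (constant -1ℤ) 1+[-1]≈0
    open BoundedMultiplicities cap (Identity.0<cap q N (s≤s z≤n) q^N≈0 c i₁)
    open SparsePartitions k

    -- The coefficient of q^n in an identity modulo q^(n+1). Coefficients are integers because of
    -- the constant -1, so the two counts are compared through the embedding of ℕ.
    equinumerous : length (ofSum n (enumCapped M 0)) ≡ length (ofSum n (enumD N 0 c))
    equinumerous = ℤₚ.+-injective (trans (sym (GF-coefficient N n (enumCapped M 0)))
      (trans (Identity.GF-enumCapped≈GF-enumD q N (s≤s z≤n) q^N≈0 c i₁ n ℕₚ.≤-refl) (GF-coefficient N n (enumD N 0 c))))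

    n≤M : n ≤ M
    n≤M = ℕₚ.≤-trans (ℕₚ.n≤1+n n) (ℕₚ.m≤m*n N (4 * k))

    mult>0 : ∀ {x b} → x ∈ b → 0 < mult x b
    mult>0 {x} {_ ∷ b} (here refl) = subst (0 <_) (sym (mult-here x b)) (s≤s z≤n)
    mult>0 {x} {y ∷ b} (there x∈)  = ℕₚ.≤-trans (mult>0 x∈) (mult≤mult-∷ x y b)

    allowed⇒capped : ∀ b → All (1 ≤_) b → sum b ≡ n → All (T ∘ allowedPart k i) b → Capped b
    allowed⇒capped b b>0 refl allowed y with allowedPart k i y in eq
    ... | true  = s≤s (mult≤sum y b b>0)
    ... | false = s≤s (ℕₚ.≤-reflexive (mult-absent y b (All.map (λ { ok refl → subst T eq ok }) allowed)))

    capped⇒allowed : ∀ b → Capped b → All (T ∘ allowedPart k i) b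
    capped⇒allowed b capped = All.tabulate λ {x} x∈ → allowed x (mult>0 x∈) (capped x)
      where
      allowed : ∀ x → 0 < mult x b → mult x b < cap x → T (allowedPart k i x)
      allowed x 0<mult mult<cap with allowedPart k i x
      ... | true  = _
      ... | false = contradiction 0<mult (ℕₚ.<⇒≱ mult<cap)

    LHS↔Fin : LHS k i n ↔ Fin (length (ofSum n (enumCapped M 0)))
    LHS↔Fin = subset↔Fin (all (allowedPart k i)) _ (Uniqueₚ.filter⁺ _ unique)
      (λ {b} partition allowed → let b>0 , b↘ , sum≡n = to (isPartition⇔ n b) partition in
        ∈-filter⁺ (λ b → sum b ≟ n) (complete ((b↘ , b>0 , All.map (λ x≤ → ℕₚ.≤-trans x≤ (ℕₚ.≤-trans (ℕₚ.≤-reflexive sum≡n) n≤M)) (parts≤sum b)) ,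
          allowed⇒capped b b>0 sum≡n (to (all⇔All (allowedPart k i) b) allowed))) sum≡n)
      (λ {b} b∈ → let b∈′ , sum≡n = ∈-filter⁻ (λ b → sum b ≟ n) b∈ ; (b↘ , b>0 , _) , capped = sound b∈′ in
        from (isPartition⇔ n b) (b>0 , b↘ , sum≡n) , from (all⇔All (allowedPart k i) b) (capped⇒allowed b capped))
      where
      unique = proj₁ (enumCapped-enumerates M 0 M refl)
      sound = λ {b} → proj₁ (proj₂ (enumCapped-enumerates M 0 M refl)) {b}
      complete = λ {b} → proj₂ (proj₂ (enumCapped-enumerates M 0 M refl)) {b}

    RHS↔Fin : RHS k i n ↔ Fin (length (ofSum n (enumD N 0 c)))
    RHS↔Fin = subset↔Fin (λ b → noRepeatedOdd b ∧ diffCond k b ∧ (countOneTwo b ℕ.≤ᵇ k ∸ i)) _ (Uniqueₚ.filter⁺ _ unique)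
      (λ {b} partition gaps → let b>0 , b↘ , sum≡n = to (isPartition⇔ n b) partition in
        ∈-filter⁺ (λ b → sum b ≟ n) (complete ((b↘ , b>0 , All.map (λ x≤ → ℕₚ.≤-trans x≤ (ℕₚ.≤-trans (ℕₚ.≤-reflexive sum≡n) n≤N*2)) (parts≤sum b)) ,
          subst (λ t → SparseD 0 t b) k∸i≡c (to (gap-conditions⇔ (c + i₁) (k ∸ i) b b>0 b↘) gaps))) sum≡n)
      (λ {b} b∈ → let b∈′ , sum≡n = ∈-filter⁻ (λ b → sum b ≟ n) b∈ ; (b↘ , b>0 , _) , sparse = sound b∈′ in
        from (isPartition⇔ n b) (b>0 , b↘ , sum≡n) ,
        from (gap-conditions⇔ (c + i₁) (k ∸ i) b b>0 b↘) (subst (λ t → SparseD 0 t b) (sym k∸i≡c) sparse))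
      where
      k∸i≡c : k ∸ i ≡ c
      k∸i≡c = ℕₚ.m+n∸n≡m c i₁
      n≤N*2 : n ≤ N * 2
      n≤N*2 = ℕₚ.≤-trans (ℕₚ.n≤1+n n) (ℕₚ.m≤m*n N 2)
      enumerates = enumD-enumerates N 0 N c refl (s≤s (ℕₚ.m≤m+n c i₁))
      unique = proj₁ enumerates
      sound = λ {b} → proj₁ (proj₂ enumerates) {b}
      complete = λ {b} → proj₂ (proj₂ enumerates) {b}

    LHS↔RHS : LHS k i n ↔ RHS k i n
    LHS↔RHS = ↔-trans LHS↔Fin (subst (λ m → Fin m ↔ RHS k i n) (sym equinumerous) (↔-sym RHS↔Fin))

theorem6p3 : (k i n : ℕ) → .{{_ : NonZero k}} → 1 ≤ i → i ≤ k →
    LHS k i n ↔ RHS k i n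
theorem6p3 k (suc i₁) n _ i≤k = reindex (k ℕ.∸ suc i₁) (≡.trans (≡.sym (ℕₚ.+-suc _ i₁)) (ℕₚ.m∸n+n≡m i≤k))
  where
  -- With c = k ∸ i and i₁ = i - 1 as parameters, k = suc (c + i₁) is positive and i ≤ k holds by
  -- construction.
  reindex : ∀ {k} .{{_ : NonZero k}} c → suc (c ℕ.+ i₁) ≡ k → LHS k (suc i₁) n ↔ RHS k (suc i₁) n
  reindex c ≡.refl = Bijections.LHS↔RHS c i₁ n
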